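{- Let $\mathbb B$ be a complete Boolean algebra and $U$ an ultrafilter on $\mathbb B$ such that $\mathrm V^{\mathbb B}/U$ is well-founded. If there is a simple skeleton $\mathfrak A$ for $(\mathbb B,U)$, then the Bukovský–Dehornoy phenomenon holds for the Boolean ultrapower of $\mathrm V$ by $U$, that is, \[\mathrm V^{\mathbb B}/U=\bigcap_{A\in\mathfrak A}M_A.\]
   Context: Let $U\in\mathrm V$ be an ultrafilter on $\mathbb B$. $\mathrm V^{\mathbb B}/U$ consists of the classes $[\sigma]_U$ of $\mathbb B$-names under $\sigma\sim\tau$ iff $[\![\sigma=\tau]\!]\in U$, with $[\sigma]_U\,E\,[\tau]_U$ iff $[\![\sigma\in\tau]\!]\in U$. The Boolean ultrapower $\check{\mathrm V}_U\subseteq\mathrm V^{\mathbb B}/U$ consists of the classes of names with $[\![\sigma\in\check{\mathrm V}]\!]=\bigvee_{x\in\mathrm V}[\![\sigma=\check x]\!]\in U$, and $j:\mathrm V\to\check{\mathrm V}_U$, $j(x)=[\check x]_U$, is the Boolean ultrapower embedding. $\dot G$ is the canonical name for the generic filter and $G=[\dot G]_U$; $G$ is $j(\mathbb B)$-generic over $\check{\mathrm V}_U$ and $\check{\mathrm V}_U[G]=\mathrm V^{\mathbb B}/U$. As $\mathrm V^{\mathbb B}/U$ is well-founded, all these models are taken to be transitive. For a maximal antichain $A\subseteq\mathbb B$ (of nonzero elements), $U_A=\{X\subseteq A\mid\bigvee X\in U\}$, $M_A$ is the (transitive) ultrapower of $\mathrm V$ by $U_A$, $\pi_{0,A}:\mathrm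 V\to M_A$ is the ultrapower embedding, and $b_A$ is the unique element of $j(A)\cap G$. $B\le^*A$ ($B$ refines $A$) means every $b\in B$ is below some $a\in A$; then $\pi_{A,B}:M_A\to M_B$ sends $[f]_{U_A}$ to the class of $b\mapsto f(a)$, $a\in A$ unique with $b\le a$. $\check{\mathrm V}_U$ is the direct limit of this system, with direct limit maps $\pi_{A,\infty}:M_A\to\check{\mathrm V}_U$, $\pi_{A,\infty}([f]_{U_A})=j(f)(b_A)$. Let $G_A=\pi_{A,\infty}^{ -1}[G]$. The antichain $A$ is simple (with respect to $U$) if $G_A\in M_A$. A skeleton for $(\mathbb B,U)$ is a set $\mathfrak A$ of maximal antichains of $\mathbb B$ such that (1) $\mathfrak A$ is directed under refinement (any two members have a common refinement in $\mathfrak A$), (2) $j[\mathfrak A]=\{j(A)\mid A\in\mathfrak A\}\in\mathrm V^{\mathbb B}/U$, and (3) $\check{\mathrm V}_U=\{j(f)(b_A)\mid A\in\mathfrak A,\ f:A\to\mathrm V\}$. It is simple if every $A\in\mathfrak A$ is simple. -}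

module Defs where

open import Level using (Level; Lift; lift; suc; _⊔_)
open import Algebra.Lattice.Bundles using (BooleanAlgebra)
import Algebra.Lattice.Properties.Lattice as LatticeProperties
open import Data.Bool.Base using (Bool; if_then_else_)
open import Data.Product.Base using (Σ; Σ-syntax; ∃; ∃-syntax; _×_; _,_; proj₁; proj₂)
open import Data.Sum.Base using (_⊎_)
open import Function.Bundles using (Func; _⇔_; _⟶ₛ_)
open import Relation.Binary.Bundles using (Poset; Setoid)
open import Relation.Binary.Core using (Rel)
open import Relation.Binary.Definitions using (_Respects_)
open import Relation.Binary.PropositionalEquality.Core using (_≡_)
open import Relation.Binary.Structures using (IsEquivalence)
import Relation.Binary.Construct.On as On
open import Relation.Nullary.Negation.Core using () renaming (¬_ to Not_)
open import Relation.Unary using (Pred; _⊆_)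

-- The axiom of choice, in the form: every partition has a transversal.
Choice : ∀ ℓ → Set (suc ℓ)
Choice ℓ = (S : Setoid ℓ ℓ) → let open Setoid S in
  Σ[ rep ∈ (Carrier → Carrier) ]
    (∀ x → rep x ≈ x) × (∀ x y → x ≈ y → rep x ≡ rep y)

------------------------------------------------------------------------
-- The universe of sets: Aczel's iterative sets over the small types
-- Set ℓ.  Small types play the role of sets and (sup I x) is the set
-- {x i | i ∈ I}.  Under excluded middle and Choice this models ZFC.
-- Classes are predicates on V.

data V (ℓ : Level) : Set (suc ℓ) where
  sup : (I : Set ℓ) → (I → V ℓ) → V ℓ

module _ {ℓ : Level} where

  infix 4 _≃_ _∈V_

  -- Extensional equality; this, not _≡_, is equality of sets.
  _≃_ : Rel (V ℓ) ℓ
  sup I x ≃ sup J y = (∀ i → ∃[ j ] x i ≃ y j) × (∀ j → ∃[ i ] x i ≃ y j)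

  _∈V_ : Rel (V ℓ) ℓ
  x ∈V sup J y = ∃[ j ] x ≃ y j

  ≃-refl : ∀ x → x ≃ x
  ≃-refl (sup I x) = (λ i → i , ≃-refl (x i)) , (λ i → i , ≃-refl (x i))

  ≃-sym : ∀ x y → x ≃ y → y ≃ x
  ≃-sym (sup I x) (sup J y) (p , q) =
    (λ j → proj₁ (q j) , ≃-sym (x (proj₁ (q j))) (y j) (proj₂ (q j))) ,
    (λ i → proj₁ (p i) , ≃-sym (x i) (y (proj₁ (p i))) (proj₂ (p i)))

  ≃-trans : ∀ x y z → x ≃ y → y ≃ z → x ≃ z
  ≃-trans (sup I x) (sup J y) (sup K z) (p , q) (r , s) =
    (λ i → let (j , e) = p i ; (k , e′) = r j in k , ≃-trans (x i) (y j) (z k) e e′) ,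
    (λ k → let (j , e′) = s k ; (i , e) = q j in i , ≃-trans (x i) (y j) (z k) e e′)

  V-setoid : Setoid (suc ℓ) ℓ
  V-setoid = record
    { Carrier = V ℓ
    ; _≈_ = _≃_
    ; isEquivalence = record
      { refl  = λ {x} → ≃-refl x
      ; sym   = λ {x} {y} → ≃-sym x y
      ; trans = λ {x} {y} {z} → ≃-trans x y z
      }
    }

  -- Kuratowski pairs.
  unorderedPair : V ℓ → V ℓ → V ℓ
  unorderedPair x y = sup (Lift ℓ Bool) λ (lift b) → if b then x else y

  orderedPair : V ℓ → V ℓ → V ℓ
  orderedPair x y = unorderedPair (unorderedPair x x) (unorderedPair x y)

------------------------------------------------------------------------
-- Class structures (M , E).  They need not be quotiented: equality of
-- the points of M is the one induced by E.

module _ {ℓ : Level} {M : Set (suc ℓ)} (E : Rel M ℓ) where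

  -- x is the image of m under the Mostowski collapse,
  -- that is, x = { collapse of n | n E m }.
  CollapsesTo : M → V ℓ → Set (suc ℓ)
  CollapsesTo m (sup I x) =
    (∀ n → E n m → ∃[ i ] CollapsesTo n (x i)) ×
    (∀ i → ∃[ n ] E n m × CollapsesTo n (x i))

  -- The transitive class to which (M , E) collapses.
  TransitiveCollapse : Pred (V ℓ) (suc ℓ)
  TransitiveCollapse x = ∃[ m ] CollapsesTo m x

  -- The subclass P of the model belongs to the model.  When (M , E) is
  -- identified with its transitive collapse, the point m is the set of
  -- all points n with n E m.
  BelongsTo : ∀ {p} → Pred M p → Set (suc ℓ ⊔ p)
  BelongsTo P = ∃[ m ] ∀ n → E n m ⇔ P n

------------------------------------------------------------------------

-- A complete Boolean algebra in V.  Its underlying set is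
-- {code b | b : Carrier}; every set of V arises as such an image, so
-- giving codes is the same as giving the algebra as an element of V.
record CompleteBooleanAlgebra (ℓ : Level) : Set (suc ℓ) where
  field
    booleanAlgebra : BooleanAlgebra ℓ ℓ

  open BooleanAlgebra booleanAlgebra public
  open Poset (LatticeProperties.poset lattice) public using (_≤_)

  IsSupremum : ∀ {i} {I : Set i} → (I → Carrier) → Carrier → Set (i ⊔ ℓ)
  IsSupremum F s = (∀ i → F i ≤ s) × (∀ u → (∀ i → F i ≤ u) → s ≤ u)

  field
    ⋁            : {I : Set ℓ} → (I → Carrier) → Carrier
    ⋁-isSupremum : {I : Set ℓ} (F : I → Carrier) → IsSupremum F (⋁ F)
    code         : Carrier → V ℓ
    code-≃       : ∀ x y → x ≈ y ⇔ code x ≃ code y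

  ⋀ : {I : Set ℓ} → (I → Carrier) → Carrier
  ⋀ F = ¬ ⋁ (λ i → ¬ F i)

  infixr 5 _⇒_
  _⇒_ : Carrier → Carrier → Carrier
  x ⇒ y = ¬ x ∨ y

module _ {ℓ : Level} (𝔹 : CompleteBooleanAlgebra ℓ) where
  open CompleteBooleanAlgebra 𝔹

  record Ultrafilter : Set (suc ℓ) where
    field
      member   : Pred Carrier ℓ
      resp     : member Respects _≈_
      ⊤-mem    : member ⊤
      ⊥-nonmem : Not member ⊥
      up       : ∀ x y → x ≤ y → member x → member y
      ∧-mem    : ∀ x y → member x → member y → member (x ∧ y)
      ultra    : ∀ x → member x ⊎ member (¬ x)

  record IsAntichain (A : Pred Carrier ℓ) : Set ℓ where
    field
      resp         : A Respects _≈_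
      nonzero      : ∀ a → A a → a ≉ ⊥
      incompatible : ∀ a a′ → A a → A a′ → a ≉ a′ → a ∧ a′ ≈ ⊥

  record MaximalAntichain : Set (suc ℓ) where
    field
      member      : Pred Carrier ℓ
      isAntichain : IsAntichain member
      maximal     : (A : Pred Carrier ℓ) → IsAntichain A → member ⊆ A → A ⊆ member

    Elem : Set ℓ
    Elem = Σ Carrier member

    elemSetoid : Setoid ℓ ℓ
    elemSetoid = On.setoid {B = Elem} setoid proj₁

    asSet : V ℓ
    asSet = sup Elem λ (a , _) → code a

  open MaximalAntichain using (Elem; elemSetoid; asSet)

  infix 4 _≤*_
  _≤*_ : MaximalAntichain → MaximalAntichain → Set ℓ
  B ≤* A = ∀ ((b , _) : Elem B) → Σ[ (a , _) ∈ Elem A ] b ≤ a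

  -- The functions f : A → V, and their graphs as elements of V.
  FunctionOn : MaximalAntichain → Set (suc ℓ)
  FunctionOn A = elemSetoid A ⟶ₛ V-setoid

  graph : (A : MaximalAntichain) → FunctionOn A → V ℓ
  graph A f = sup (Elem A) λ a → orderedPair (code (proj₁ a)) (Func.to f a)

  ----------------------------------------------------------------------
  -- Boolean-valued models

  -- (name I σ b) is the name {(σ i , b i) | i ∈ I}.
  data Name : Set (suc ℓ) where
    name : (I : Set ℓ) → (I → Name) → (I → Carrier) → Name

  infix 9 ⟦_≐_⟧ ⟦_∈_⟧
  ⟦_≐_⟧ ⟦_∈_⟧ : Name → Name → Carrier
  ⟦ σ@(name I s b) ≐ τ@(name J t c) ⟧ =
    ⋀ (λ i → b i ⇒ ⟦ s i ∈ τ ⟧) ∧ ⋀ (λ j → c j ⇒ ⟦ t j ∈ σ ⟧)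
  ⟦ σ ∈ name J t c ⟧ = ⋁ (λ j → c j ∧ ⟦ σ ≐ t j ⟧)

  check : V ℓ → Name
  check (sup I x) = name I (λ i → check (x i)) (λ _ → ⊤)

  Ġ : Name
  Ġ = name Carrier (λ b → check (code b)) (λ b → b)

  unorderedPairName : Name → Name → Name
  unorderedPairName σ τ =
    name (Lift ℓ Bool) (λ (lift b) → if b then σ else τ) (λ _ → ⊤)

  orderedPairName : Name → Name → Name
  orderedPairName σ τ =
    unorderedPairName (unorderedPairName σ σ) (unorderedPairName σ τ)

  module _ (U : Ultrafilter) where
    open Ultrafilter U using () renaming (member to _∈U)

    -- The structure V^𝔹/U: names with equality _∼_ and membership _E_.
    infix 4 _∼_ _E_
    _∼_ _E_ : Rel Name ℓ
    σ ∼ τ = ⟦ σ ≐ τ ⟧ ∈U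
    σ E τ = ⟦ σ ∈ τ ⟧ ∈U

    -- The Boolean ultrapower V̌_U.  The supremum of ⟦ σ ≐ x̌ ⟧ over all x
    -- in V has a large index type, so it is not an instance of ⋁.
    Ground : Pred Name (suc ℓ)
    Ground σ = ∃[ s ] IsSupremum (λ (x : V ℓ) → ⟦ σ ≐ check x ⟧) s × s ∈U

    j : V ℓ → Name
    j = check

    --------------------------------------------------------------------
    -- The ultrapower M_A

    -- X ∈ U_A, for X ⊆ A.
    UltrafilterOn : (A : MaximalAntichain) → Pred (Elem A) ℓ → Set ℓ
    UltrafilterOn A X = ⋁ {I = ∃ X} (λ ((a , _) , _) → a) ∈U

    E[_] : (A : MaximalAntichain) → Rel (FunctionOn A) ℓ
    E[ A ] f g = UltrafilterOn A λ a → Func.to f a ∈V Func.to g a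

    -- β represents b_A, the element of j(A) ∩ G.
    Is-b : MaximalAntichain → Pred Name ℓ
    Is-b A β = β E j (asSet A) × β E Ġ

    -- σ represents j(f)(b_A), which is π_{A,∞} of the class of f.
    Is-π∞ : (A : MaximalAntichain) → FunctionOn A → Pred Name (suc ℓ)
    Is-π∞ A f σ = ∃[ β ] Is-b A β × orderedPairName β σ E j (graph A f)

    -- G_A, the preimage of G under π_{A,∞}.
    G[_] : (A : MaximalAntichain) → Pred (FunctionOn A) (suc ℓ)
    G[ A ] f = ∃[ σ ] Is-π∞ A f σ × σ E Ġ

    Simple : Pred MaximalAntichain (suc ℓ)
    Simple A = BelongsTo E[ A ] G[ A ]

    --------------------------------------------------------------------

    BooleanModel : Pred (V ℓ) (suc ℓ)
    BooleanModel = TransitiveCollapse _E_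

    M[_] : MaximalAntichain → Pred (V ℓ) (suc ℓ)
    M[ A ] = TransitiveCollapse E[ A ]

    -- The set of antichains {𝔄 i | i ∈ I}.
    record IsSkeleton {I : Set ℓ} (𝔄 : I → MaximalAntichain) : Set (suc ℓ) where
      field
        directed : ∀ i k → ∃[ m ] 𝔄 m ≤* 𝔄 i × 𝔄 m ≤* 𝔄 k
        j[𝔄]∈    : BelongsTo _E_ λ σ → ∃[ i ] σ ∼ j (asSet (𝔄 i))
        generate : ∀ σ → Ground σ ⇔ (∃[ i ] Σ[ f ∈ FunctionOn (𝔄 i) ] Is-π∞ (𝔄 i) f σ)

-- For a simple antichain A, Łoś's theorem turns the point of M_A representing G_A into a
-- function d ↦ H d from A to subsets of 𝔹, and V^𝔹/U is the Boolean ultrapower of M_A by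
-- G_A as computed inside M_A: the collapse of a name σ in V^𝔹/U is the class of the
-- function sending d to the collapse of σ under the relation ⟦ _ ∈ _ ⟧ ∈ H d.
-- Hence V^𝔹/U ⊆ M_A.
--
-- Conversely, by ∈-induction let x = {x k | k ∈ J} with x k the collapse of a name σ k,
-- and let x be the class of f_A in M_A for every A ∈ 𝔄.  Let φ(υ) be the Boolean value of
-- "for all j(A) ∈ j[𝔄], the collapse of υ under H_A(b_A) belongs to f_A(b_A)", and put
-- τ = {(σ k, φ(σ k)) | k ∈ J}.  As j[𝔄] belongs to V^𝔹/U, all φ(σ k) lie in U.  A member
-- of τ is named by some σ k with k varying over a disjoint family of conditions; this
-- variation is a point of the ground model, hence of the form j(g)(b_A) with A ∈ 𝔄, and
-- the conjunct of φ at this A puts the member into x.  So τ collapses to x.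

module Submission where

open import Defs
open import Level using (Level; suc; lift) renaming (zero to 0ℓ)
open import Axiom.ExcludedMiddle using (ExcludedMiddle)
open import Axiom.UniquenessOfIdentityProofs.WithK using (uip)
open import Induction.WellFounded using (WellFounded; Acc; acc)
import Algebra.Lattice.Properties.BooleanAlgebra as BooleanAlgebraProperties
open import Data.Bool.Base using (Bool; true; false; T)
open import Data.Empty.Polymorphic using () renaming (⊥ to Empty)
open import Data.Product.Base using (Σ; Σ-syntax; ∃; ∃-syntax; _×_; _,_; proj₁; proj₂)
open import Data.Sum.Base using (_⊎_; inj₁; inj₂; [_,_]′)
open import Function.Base using (_∘_; id)
open import Function.Bundles using (Equivalence; Func)
open import Relation.Binary.Bundles using (Poset; Setoid)
open import Relation.Binary.Core using (Rel)
import Relation.Binary.Construct.On as On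
import Relation.Binary.Lattice as Order
open import Relation.Binary.PropositionalEquality.Core using (_≡_; refl; sym; trans; cong; subst)
open import Relation.Nullary.Decidable.Core using (yes; no; isYes; True; toWitness; fromWitness)
open import Relation.Nullary.Negation.Core using (contradiction) renaming (¬_ to Not_)
open import Relation.Unary using (Pred)

-- Sets and collapses

module _ {ℓ : Level} where

  ∈V-respˡ : {x y : V ℓ} (z : V ℓ) → x ≃ y → y ∈V z → x ∈V z
  ∈V-respˡ {x} {y} (sup K z) e (k , e′) = k , ≃-trans x y (z k) e e′

  ∈V-respʳ : (x y z : V ℓ) → y ≃ z → x ∈V y → x ∈V z
  ∈V-respʳ x (sup J y) (sup K z) (p , _) (j , e) = let (k , e′) = p j in k , ≃-trans x (y j) (z k) e e′

  ∈V-ext : (x y : V ℓ) → (∀ z → z ∈V x → z ∈V y) → (∀ z → z ∈V y → z ∈V x) → x ≃ y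
  ∈V-ext (sup I x) (sup J y) p q =
    (λ i → p (x i) (i , ≃-refl (x i))) ,
    (λ j → let (i , e) = q (y j) (j , ≃-refl (y j)) in i , ≃-sym (y j) (x i) e)

  ∅V : V ℓ
  ∅V = sup Empty λ ()

  module _ {M : Set (suc ℓ)} (R : Rel M ℓ) where

    CollapsesTo-unique : ∀ {m} x y → CollapsesTo R m x → CollapsesTo R m y → x ≃ y
    CollapsesTo-unique (sup I x) (sup J y) (p , p′) (q , q′) =
      (λ i → let (n , nRm , c) = p′ i ; (j , c′) = q n nRm in
             j , CollapsesTo-unique (x i) (y j) c c′) ,
      (λ j → let (n , nRm , c′) = q′ j ; (i , c) = p n nRm in
             i , CollapsesTo-unique (x i) (y j) c c′)

    CollapsesTo-resp-≃ : ∀ {m} x y → x ≃ y → CollapsesTo R m x → CollapsesTo R m y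
    CollapsesTo-resp-≃ (sup I x) (sup J y) (e , e′) (p , q) =
      (λ n nRm → let (i , c) = p n nRm ; (j , xi≃yj) = e i in
                 j , CollapsesTo-resp-≃ (x i) (y j) xi≃yj c) ,
      (λ j → let (i , xi≃yj) = e′ j ; (n , nRm , c) = q i in
             n , nRm , CollapsesTo-resp-≃ (x i) (y j) xi≃yj c)

    -- Points are not quotiented, so equality of points enters only as having the same `R`-members.
    CollapsesTo-resp-ext : ∀ {m m′} → (∀ {n} → R n m → R n m′) → (∀ {n} → R n m′ → R n m) →
                           ∀ x → CollapsesTo R m x → CollapsesTo R m′ x
    CollapsesTo-resp-ext to from (sup I x) (p , q) =
      (λ n → p n ∘ from) , (λ i → let (n , nRm , c) = q i in n , to nRm , c)

    CollapsesTo-∈ : ∀ {n m} x → CollapsesTo R m x → R n m → ∃[ y ] y ∈V x × CollapsesTo R n y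
    CollapsesTo-∈ (sup I x) (p , _) nRm = let (i , c) = p _ nRm in x i , (i , ≃-refl (x i)) , c

    CollapsesTo-∋ : ∀ {m} x y → CollapsesTo R m x → y ∈V x → ∃[ n ] R n m × CollapsesTo R n y
    CollapsesTo-∋ (sup I x) y (_ , q) (i , e) =
      let (n , nRm , c) = q i in
      n , nRm , CollapsesTo-resp-≃ (x i) y (≃-sym y (x i) e) c

-- Well-orders

module WellOrder (em : ∀ {a} → ExcludedMiddle a) {ℓ : Level} (choice : Choice ℓ) (J : Set ℓ) where

  private
    -- Boolean-valued subsets form a type in `Set ℓ`, as `Choice ℓ` requires; excluded middle turns
    -- any predicate into one by `⟪_⟫`.
    Sub : Set ℓ
    Sub = J → Bool

    infix 4 _∈_ _⊑_
    _∈_ : J → Sub → Set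
    k ∈ P = T (P k)

    _⊑_ : Rel Sub ℓ
    P ⊑ Q = ∀ {k} → k ∈ P → k ∈ Q

    ⟪_⟫ : ∀ {a} → Pred J a → Sub
    ⟪ Q ⟫ k = isYes (em {P = Q k})

    -- A transversal of this partition is Zermelo's choice function: each class is a proper subset
    -- with all its missing points, and the representative singles out one of them.
    Missing : Setoid ℓ ℓ
    Missing = record
      { Carrier = Σ[ P ∈ Sub ] Σ[ k ∈ J ] Not (k ∈ P)
      ; _≈_ = λ (P , _) (Q , _) → P ⊑ Q × Q ⊑ P
      ; isEquivalence = record
        { refl  = id , id
        ; sym   = λ (p , q) → q , p
        ; trans = λ (p , q) (p′ , q′) → p′ ∘ p , q ∘ q′
        }
      }

    open Setoid Missing using () renaming (Carrier to Gap; _≈_ to _≈ᴳ_)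

    pick : Gap → J
    pick g = proj₁ (proj₂ (proj₁ (choice Missing) g))

    pick-∉ : ∀ g → Not (pick g ∈ proj₁ g)
    pick-∉ g = proj₂ (proj₂ (proj₁ (choice Missing) g)) ∘ proj₂ (proj₁ (proj₂ (choice Missing)) g)

    pick-cong : ∀ g h → g ≈ᴳ h → pick g ≡ pick h
    pick-cong g h e = cong (λ x → proj₁ (proj₂ x)) (proj₂ (proj₂ (choice Missing)) g h e)

    -- All `m` give the same picked point, by `pick-cong`. There is no `m` when `P` exhausts `J`,
    -- and then nothing is added.
    next : Sub → Sub
    next P = ⟪ (λ k → k ∈ P ⊎ (∃[ m ] k ≡ pick (P , m))) ⟫

    ⋃ : (Sub → Bool) → Sub
    ⋃ 𝒫 = ⟪ (λ k → ∃[ P ] T (𝒫 P) × k ∈ P) ⟫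

    ⊑-next : ∀ {P} → P ⊑ next P
    ⊑-next k∈P = fromWitness (inj₁ k∈P)

    pick-∈-next : ∀ g → pick g ∈ next (proj₁ g)
    pick-∈-next (P , m) = fromWitness (inj₂ (m , refl))

    next-cong : ∀ {P Q} → P ⊑ Q → Q ⊑ P → next P ⊑ next Q
    next-cong {P} {Q} P⊑Q Q⊑P k∈ with toWitness k∈
    ... | inj₁ k∈P = ⊑-next (P⊑Q k∈P)
    ... | inj₂ ((i , i∉P) , refl) =
      fromWitness (inj₂ ((i , i∉P ∘ Q⊑P) , pick-cong _ _ (P⊑Q , Q⊑P)))

    ⊑-⋃ : ∀ 𝒫 {P} → T (𝒫 P) → P ⊑ ⋃ 𝒫
    ⊑-⋃ 𝒫 {P} P∈𝒫 k∈P = fromWitness (P , P∈𝒫 , k∈P)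

    ⋃-⊑ : ∀ 𝒫 {Q} → (∀ P → T (𝒫 P) → P ⊑ Q) → ⋃ 𝒫 ⊑ Q
    ⋃-⊑ 𝒫 h k∈ = let (P , P∈𝒫 , k∈P) = toWitness k∈ in h P P∈𝒫 k∈P

    -- The initial segments of the well-order under construction.
    data Segment : Sub → Set ℓ where
      step  : ∀ {P} → Segment P → Segment (next P)
      union : ∀ 𝒫 → (∀ P → T (𝒫 P) → Segment P) → Segment (⋃ 𝒫)

    -- Induction on `Q`. A successor cannot jump over `P`: if its predecessor coincides with `P`,
    -- then `next-cong` applies. A union either has a stage above `next P` or has all its stages
    -- inside `P`.
    next-⊑-or-⊒ : ∀ {P} → (∀ {Q} → Segment Q → P ⊑ Q ⊎ next Q ⊑ P) →
                  ∀ {Q} → Segment Q → P ⊑ Q → next P ⊑ Q ⊎ Q ⊑ P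
    next-⊑-or-⊒ cmp (step Q) _ with cmp Q
    ... | inj₂ s = inj₂ s
    ... | inj₁ P⊑Q with next-⊑-or-⊒ cmp Q P⊑Q
    ...   | inj₁ s = inj₁ (λ k∈ → ⊑-next (s k∈))
    ...   | inj₂ Q⊑P = inj₁ (next-cong P⊑Q Q⊑P)
    next-⊑-or-⊒ {P} cmp (union 𝒬 t) _ with em {P = ∃[ Q ] T (𝒬 Q) × next P ⊑ Q}
    ... | yes (Q , Q∈𝒬 , s) = inj₁ (λ k∈ → ⊑-⋃ 𝒬 Q∈𝒬 (s k∈))
    ... | no ¬s = inj₂ (⋃-⊑ 𝒬 below)
      where
      below : ∀ Q → T (𝒬 Q) → Q ⊑ P
      below Q Q∈𝒬 with cmp (t Q Q∈𝒬)
      ... | inj₂ s = λ k∈ → s (⊑-next k∈)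
      ... | inj₁ P⊑Q with next-⊑-or-⊒ cmp (t Q Q∈𝒬) P⊑Q
      ...   | inj₁ s = contradiction (Q , Q∈𝒬 , λ {k} → s {k}) ¬s
      ...   | inj₂ Q⊑P = Q⊑P

    -- Induction on the segment `P`; in the successor case the induction hypothesis is the
    -- comparability that `next-⊑-or-⊒` asks for.
    compare : ∀ {P Q} → Segment P → Segment Q → P ⊑ Q ⊎ next Q ⊑ P
    compare (step P) Q with compare P Q
    ... | inj₂ s = inj₂ (λ k∈ → ⊑-next (s k∈))
    ... | inj₁ P⊑Q with next-⊑-or-⊒ (compare P) Q P⊑Q
    ...   | inj₁ s = inj₁ s
    ...   | inj₂ Q⊑P = inj₂ (next-cong Q⊑P P⊑Q)
    compare {Q = Q} (union 𝒫 t) SQ with em {P = ∃[ P ] T (𝒫 P) × next Q ⊑ P}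
    ... | yes (P , P∈𝒫 , s) = inj₂ (λ k∈ → ⊑-⋃ 𝒫 P∈𝒫 (s k∈))
    ... | no ¬s = inj₁ (⋃-⊑ 𝒫 below)
      where
      below : ∀ P → T (𝒫 P) → P ⊑ Q
      below P P∈𝒫 with compare (t P P∈𝒫) SQ
      ... | inj₁ P⊑Q = P⊑Q
      ... | inj₂ s = contradiction (P , P∈𝒫 , λ {k} → s {k}) ¬s

    Avoiding : J → Sub → Bool
    Avoiding k P = isYes (em {P = Segment P × Not (k ∈ P)})

    -- The largest segment without `k`, so `i ≺ k` says that some segment contains `i` but not `k`.
    initial : J → Sub
    initial k = ⋃ (Avoiding k)

    initial-segment : ∀ k → Segment (initial k)
    initial-segment k = union (Avoiding k) (λ P av → proj₁ (toWitness av))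

    ∉-initial : ∀ k → Not (k ∈ initial k)
    ∉-initial k k∈ = let (P , av , k∈P) = toWitness k∈ in proj₂ (toWitness av) k∈P

    gap : J → Gap
    gap k = initial k , k , ∉-initial k

    -- Otherwise `next (initial k)` would be one more segment avoiding `k`, hence part of
    -- `initial k`, although it contains a freshly picked point.
    ∈-next-initial : ∀ k → k ∈ next (initial k)
    ∈-next-initial k with em {P = k ∈ next (initial k)}
    ... | yes k∈ = k∈
    ... | no k∉ = contradiction
      (⊑-⋃ (Avoiding k) (fromWitness (step (initial-segment k) , k∉)) (pick-∈-next (gap k)))
      (pick-∉ (gap k))

    -- Recovers `k` from its initial segment; `≺-connex` needs this when two initial segments
    -- coincide.
    pick-gap : ∀ k → k ≡ pick (gap k)
    pick-gap k with toWitness (∈-next-initial k)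
    ... | inj₁ k∈ = contradiction k∈ (∉-initial k)
    ... | inj₂ (m , e) = trans e (pick-cong _ _ (id , id))

  infix 4 _≺_
  _≺_ : Rel J 0ℓ
  i ≺ k = i ∈ initial k

  ≺-connex : ∀ i k → i ≡ k ⊎ i ≺ k ⊎ k ≺ i
  ≺-connex i k with compare (initial-segment i) (initial-segment k)
                  | compare (initial-segment k) (initial-segment i)
  ... | inj₂ s | _ = inj₂ (inj₂ (s (∈-next-initial k)))
  ... | _ | inj₂ s = inj₂ (inj₁ (s (∈-next-initial i)))
  ... | inj₁ p | inj₁ q = inj₁ (trans (pick-gap i) (trans (pick-cong _ _ (p , q)) (sym (pick-gap k))))

  private
    segment-acc : ∀ {P} → Segment P → ∀ k → k ∈ P → Acc _≺_ k
    segment-acc (union 𝒫 t) k k∈ = let (P , P∈𝒫 , k∈P) = toWitness k∈ in segment-acc (t P P∈𝒫) k k∈P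
    segment-acc {P′} (step {P} SP) k k∈ with toWitness k∈
    ... | inj₁ k∈P = segment-acc SP k k∈P
    ... | inj₂ (m , refl) = acc below
      where
      -- A segment without `k` cannot include `next P`, so it lies inside `P`, where accessibility
      -- is already known.
      below : ∀ {i} → i ≺ k → Acc _≺_ i
      below {i} i≺k with toWitness i≺k
      ... | Q , av , i∈Q with toWitness av
      ...   | SQ , k∉Q with compare SQ SP
      ...     | inj₁ Q⊑P = segment-acc SP i (Q⊑P i∈Q)
      ...     | inj₂ s = contradiction (s k∈) k∉Q

  ≺-wellFounded : WellFounded _≺_
  ≺-wellFounded k = segment-acc (step (initial-segment k)) k (∈-next-initial k)

-- Forcing and Boolean-valued names

-- Inequalities p ≤ x are read as "p forces x".
module Forcing {ℓ : Level} (𝔹 : CompleteBooleanAlgebra ℓ) where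
  open CompleteBooleanAlgebra 𝔹 hiding (refl; sym; trans)
  open BooleanAlgebraProperties booleanAlgebra
    using (poset; ∨-∧-orderTheoreticLattice; ∧-identityʳ; ∧-zeroˡ; ∨-identityʳ; ¬-involutive)
  open Poset poset public using ()
    renaming (refl to ≤-refl; trans to ≤-trans; antisym to ≤-antisym; reflexive to ≤-reflexive)
  open Order.Lattice ∨-∧-orderTheoreticLattice public using (x∧y≤x; x∧y≤y; ∧-greatest; x≤x∨y; y≤x∨y; ∨-least)
  private module ≈ = Setoid setoid

  ≤⊤ : ∀ {p} → p ≤ ⊤
  ≤⊤ = ≈.sym (∧-identityʳ _)

  ⊥≤ : ∀ {p} → ⊥ ≤ p
  ⊥≤ = ≈.sym (∧-zeroˡ _)

  ∧-fst : ∀ {p x y} → p ≤ x ∧ y → p ≤ x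
  ∧-fst h = ≤-trans h (x∧y≤x _ _)

  ∧-snd : ∀ {p x y} → p ≤ x ∧ y → p ≤ y
  ∧-snd h = ≤-trans h (x∧y≤y _ _)

  ⇒-intro : ∀ {p x y} → (∀ {q} → q ≤ p → q ≤ x → q ≤ y) → p ≤ x ⇒ y
  ⇒-intro {p} {x} {y} h =
    ≤-trans (≤-reflexive (≈.trans (≈.sym (∧-identityʳ p))
                         (≈.trans (∧-congˡ (≈.sym (∨-complementʳ x))) (∧-distribˡ-∨ p x (¬ x)))))
      (∨-least (≤-trans (h (x∧y≤x p x) (x∧y≤y p x)) (y≤x∨y (¬ x) y))
               (≤-trans (x∧y≤y p (¬ x)) (x≤x∨y (¬ x) y)))

  ⇒-elim : ∀ {p x y} → p ≤ x ⇒ y → p ≤ x → p ≤ y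
  ⇒-elim {p} {x} {y} h hx =
    ≤-trans (∧-greatest h hx)
      (≤-trans (≤-reflexive (∧-distribʳ-∨ x (¬ x) y))
        (∨-least (≤-trans (≤-reflexive (∧-complementˡ x)) ⊥≤) (x∧y≤x y x)))

  ¬-intro : ∀ {p x} → (∀ {q} → q ≤ p → q ≤ x → q ≤ ⊥) → p ≤ ¬ x
  ¬-intro {p} {x} h = ≤-trans (⇒-intro h) (≤-reflexive (∨-identityʳ (¬ x)))

  ¬-elim : ∀ {p x y} → p ≤ ¬ x → p ≤ x → p ≤ y
  ¬-elim {p} {x} h hx = ≤-trans (∧-greatest hx h) (≤-trans (≤-reflexive (∧-complementʳ x)) ⊥≤)

  ¬¬-elim : ∀ {p x} → p ≤ ¬ ¬ x → p ≤ x
  ¬¬-elim {x = x} h = ≤-trans h (≤-reflexive (¬-involutive x))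

  ∨-elim : ∀ {p x y z} → p ≤ x ∨ y →
           (∀ {q} → q ≤ p → q ≤ x → q ≤ z) → (∀ {q} → q ≤ p → q ≤ y → q ≤ z) → p ≤ z
  ∨-elim {p} h f g =
    ⇒-elim (≤-trans h (∨-least (⇒-intro λ q≤x q≤p → f q≤p q≤x) (⇒-intro λ q≤y q≤p → g q≤p q≤y))) ≤-refl

  ∨-complement-intro : ∀ {p} x → p ≤ x ∨ ¬ x
  ∨-complement-intro x = ≤-trans ≤⊤ (≤-reflexive (≈.sym (∨-complementʳ x)))

  module _ {i : Level} {I : Set i} {F : I → Carrier} {s : Carrier} (sup : IsSupremum F s) where

    sup-intro : ∀ {p} k → p ≤ F k → p ≤ s
    sup-intro k h = ≤-trans h (proj₁ sup k)

    -- Infinite distributivity in disguise: `p ⇒ z` is an upper bound of the family, hence above the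
    -- supremum.
    sup-elim : ∀ {p z} → p ≤ s → (∀ k {q} → q ≤ p → q ≤ F k → q ≤ z) → p ≤ z
    sup-elim h f = ⇒-elim (≤-trans h (proj₂ sup _ λ k → ⇒-intro λ q≤F q≤p → f k q≤p q≤F)) ≤-refl

  module _ {I : Set ℓ} {F : I → Carrier} where

    ⋁-intro : ∀ {p} k → p ≤ F k → p ≤ ⋁ F
    ⋁-intro = sup-intro (⋁-isSupremum F)

    ⋁-elim : ∀ {p z} → p ≤ ⋁ F → (∀ k {q} → q ≤ p → q ≤ F k → q ≤ z) → p ≤ z
    ⋁-elim = sup-elim (⋁-isSupremum F)

  module _ {I : Set ℓ} {F : I → Carrier} where

    ⋀-intro : ∀ {p} → (∀ k → p ≤ F k) → p ≤ ⋀ F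
    ⋀-intro h = ¬-intro λ q≤p q≤ → ⋁-elim q≤ λ k r≤q r≤¬F → ¬-elim r≤¬F (≤-trans r≤q (≤-trans q≤p (h k)))

    ⋀-elim : ∀ {p} → p ≤ ⋀ F → ∀ k → p ≤ F k
    ⋀-elim h k = ¬¬-elim (¬-intro λ q≤p q≤¬F → ¬-elim (≤-trans q≤p h) (⋁-intro k q≤¬F))

  infix 9 _≐_ _∈_
  _≐_ _∈_ : Name 𝔹 → Name 𝔹 → Carrier
  _≐_ = ⟦_≐_⟧ 𝔹
  _∈_ = ⟦_∈_⟧ 𝔹

  Index : Name 𝔹 → Set ℓ
  Index (name I _ _) = I

  element : (σ : Name 𝔹) → Index σ → Name 𝔹
  element (name _ s _) = s

  value : (σ : Name 𝔹) → Index σ → Carrier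
  value (name _ _ b) = b

  ∈-intro : ∀ {p} σ τ k → p ≤ value τ k → p ≤ σ ≐ element τ k → p ≤ σ ∈ τ
  ∈-intro σ (name K t c) k h e = ⋁-intro k (∧-greatest h e)

  ∈-elim : ∀ {p z} σ τ → p ≤ σ ∈ τ →
           (∀ k {q} → q ≤ p → q ≤ value τ k → q ≤ σ ≐ element τ k → q ≤ z) → p ≤ z
  ∈-elim σ (name K t c) h f = ⋁-elim h λ k q≤p q≤ → f k q≤p (∧-fst q≤) (∧-snd q≤)

  ≐-intro : ∀ {p} σ τ →
            (∀ i {q} → q ≤ p → q ≤ value σ i → q ≤ element σ i ∈ τ) →
            (∀ k {q} → q ≤ p → q ≤ value τ k → q ≤ element τ k ∈ σ) → p ≤ σ ≐ τ
  ≐-intro (name I s b) (name K t c) f g =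
    ∧-greatest (⋀-intro λ i → ⇒-intro (f i)) (⋀-intro λ k → ⇒-intro (g k))

  ≐-elimˡ : ∀ {p} σ τ → p ≤ σ ≐ τ → ∀ i → p ≤ value σ i → p ≤ element σ i ∈ τ
  ≐-elimˡ (name I s b) (name K t c) h i = ⇒-elim (⋀-elim (∧-fst h) i)

  ≐-elimʳ : ∀ {p} σ τ → p ≤ σ ≐ τ → ∀ k → p ≤ value τ k → p ≤ element τ k ∈ σ
  ≐-elimʳ (name I s b) (name K t c) h k = ⇒-elim (⋀-elim (∧-snd h) k)

  ≐-refl : ∀ {p} σ → p ≤ σ ≐ σ
  ≐-refl σ@(name I s b) = ≐-intro σ σ
    (λ i _ q≤b → ∈-intro (s i) σ i q≤b (≐-refl (s i)))
    (λ i _ q≤b → ∈-intro (s i) σ i q≤b (≐-refl (s i)))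

  ≐-sym : ∀ {p} σ τ → p ≤ σ ≐ τ → p ≤ τ ≐ σ
  ≐-sym (name I s b) (name K t c) h = ∧-greatest (∧-snd h) (∧-fst h)

  ≐-trans : ∀ {p} σ τ υ → p ≤ σ ≐ τ → p ≤ τ ≐ υ → p ≤ σ ≐ υ
  ≐-trans σ@(name I s b) τ@(name K t c) υ@(name L u d) σ≐τ τ≐υ = ≐-intro σ υ
    (λ i q≤p q≤b →
      ∈-elim (s i) τ (≐-elimˡ σ τ (≤-trans q≤p σ≐τ) i q≤b) λ k r≤q r≤c si≐tk →
      ∈-elim (t k) υ (≐-elimˡ τ υ (≤-trans r≤q (≤-trans q≤p τ≐υ)) k r≤c) λ l r′≤r r′≤d tk≐ul →
      ∈-intro (s i) υ l r′≤d (≐-trans (s i) (t k) (u l) (≤-trans r′≤r si≐tk) tk≐ul))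
    (λ l q≤p q≤d →
      ∈-elim (u l) τ (≐-elimʳ τ υ (≤-trans q≤p τ≐υ) l q≤d) λ k r≤q r≤c ul≐tk →
      ∈-elim (t k) σ (≐-elimʳ σ τ (≤-trans r≤q (≤-trans q≤p σ≐τ)) k r≤c) λ i r′≤r r′≤b tk≐si →
      ∈-intro (u l) σ i r′≤b
        -- Both equations are reversed so that each argument of the recursive call is a member of
        -- the corresponding original argument.
        (≐-sym (s i) (u l) (≐-trans (s i) (t k) (u l)
          (≐-sym (t k) (s i) tk≐si) (≐-sym (u l) (t k) (≤-trans r′≤r ul≐tk)))))

  ∈-respˡ : ∀ {p} σ τ υ → p ≤ σ ≐ τ → p ≤ σ ∈ υ → p ≤ τ ∈ υ
  ∈-respˡ σ τ υ σ≐τ σ∈υ = ∈-elim σ υ σ∈υ λ k q≤p q≤d σ≐uk →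
    ∈-intro τ υ k q≤d (≐-trans τ σ (element υ k) (≐-sym σ τ (≤-trans q≤p σ≐τ)) σ≐uk)

  ∈-respʳ : ∀ {p} σ τ υ → p ≤ τ ≐ υ → p ≤ σ ∈ τ → p ≤ σ ∈ υ
  ∈-respʳ σ τ υ τ≐υ σ∈τ = ∈-elim σ τ σ∈τ λ k q≤p q≤c σ≐tk →
    ∈-respˡ (element τ k) σ υ (≐-sym σ (element τ k) σ≐tk) (≐-elimˡ τ υ (≤-trans q≤p τ≐υ) k q≤c)

  check-≃ : ∀ {p} x y → x ≃ y → p ≤ check 𝔹 x ≐ check 𝔹 y
  check-≃ (sup I x) (sup K y) (f , g) = ≐-intro (check 𝔹 (sup I x)) (check 𝔹 (sup K y))
    (λ i _ _ → let (k , e) = f i in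
      ∈-intro (check 𝔹 (x i)) (check 𝔹 (sup K y)) k ≤⊤ (check-≃ (x i) (y k) e))
    (λ k _ _ → let (i , e) = g k in
      ∈-intro (check 𝔹 (y k)) (check 𝔹 (sup I x)) i ≤⊤
        (≐-sym (check 𝔹 (x i)) (check 𝔹 (y k)) (check-≃ (x i) (y k) e)))

  check-∈-intro : ∀ {p} σ I (x : I → V ℓ) i → p ≤ σ ≐ check 𝔹 (x i) → p ≤ σ ∈ check 𝔹 (sup I x)
  check-∈-intro σ I x i = ∈-intro σ (check 𝔹 (sup I x)) i ≤⊤

  check-∈-elim : ∀ {p z} σ I (x : I → V ℓ) → p ≤ σ ∈ check 𝔹 (sup I x) →
                 (∀ i {q} → q ≤ p → q ≤ σ ≐ check 𝔹 (x i) → q ≤ z) → p ≤ z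
  check-∈-elim σ I x h f = ∈-elim σ (check 𝔹 (sup I x)) h λ i q≤p _ → f i q≤p

  unorderedPair-∈-introˡ : ∀ {p} υ σ τ → p ≤ υ ≐ σ → p ≤ υ ∈ unorderedPairName 𝔹 σ τ
  unorderedPair-∈-introˡ υ σ τ = ∈-intro υ (unorderedPairName 𝔹 σ τ) (lift true) ≤⊤

  unorderedPair-∈-introʳ : ∀ {p} υ σ τ → p ≤ υ ≐ τ → p ≤ υ ∈ unorderedPairName 𝔹 σ τ
  unorderedPair-∈-introʳ υ σ τ = ∈-intro υ (unorderedPairName 𝔹 σ τ) (lift false) ≤⊤

  unorderedPair-∈-elim : ∀ {p z} υ σ τ → p ≤ υ ∈ unorderedPairName 𝔹 σ τ →
    (∀ {q} → q ≤ p → q ≤ υ ≐ σ → q ≤ z) → (∀ {q} → q ≤ p → q ≤ υ ≐ τ → q ≤ z) → p ≤ z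
  unorderedPair-∈-elim υ σ τ h f g = ∈-elim υ (unorderedPairName 𝔹 σ τ) h λ
    { (lift true)  q≤p _ → f q≤p
    ; (lift false) q≤p _ → g q≤p
    }

  unorderedPair-cong : ∀ {p} σ σ′ τ τ′ → p ≤ σ ≐ σ′ → p ≤ τ ≐ τ′ →
                       p ≤ unorderedPairName 𝔹 σ τ ≐ unorderedPairName 𝔹 σ′ τ′
  unorderedPair-cong σ σ′ τ τ′ f g = ≐-intro (unorderedPairName 𝔹 σ τ) (unorderedPairName 𝔹 σ′ τ′)
    (λ { (lift true)  q≤p _ → unorderedPair-∈-introˡ σ σ′ τ′ (≤-trans q≤p f)
       ; (lift false) q≤p _ → unorderedPair-∈-introʳ τ σ′ τ′ (≤-trans q≤p g) })
    (λ { (lift true)  q≤p _ → unorderedPair-∈-introˡ σ′ σ τ (≐-sym σ σ′ (≤-trans q≤p f))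
       ; (lift false) q≤p _ → unorderedPair-∈-introʳ τ′ σ τ (≐-sym τ τ′ (≤-trans q≤p g)) })

  orderedPair-cong : ∀ {p} σ σ′ τ τ′ → p ≤ σ ≐ σ′ → p ≤ τ ≐ τ′ →
                     p ≤ orderedPairName 𝔹 σ τ ≐ orderedPairName 𝔹 σ′ τ′
  orderedPair-cong σ σ′ τ τ′ f g =
    unorderedPair-cong (unorderedPairName 𝔹 σ σ) (unorderedPairName 𝔹 σ′ σ′)
                       (unorderedPairName 𝔹 σ τ) (unorderedPairName 𝔹 σ′ τ′)
      (unorderedPair-cong σ σ′ σ σ′ f f) (unorderedPair-cong σ σ′ τ τ′ f g)

  check-unorderedPair : ∀ {p} x y →
    p ≤ check 𝔹 (unorderedPair x y) ≐ unorderedPairName 𝔹 (check 𝔹 x) (check 𝔹 y)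
  check-unorderedPair x y =
    ≐-intro (check 𝔹 (unorderedPair x y)) (unorderedPairName 𝔹 (check 𝔹 x) (check 𝔹 y))
      (λ { (lift true)  _ _ → unorderedPair-∈-introˡ (check 𝔹 x) (check 𝔹 x) (check 𝔹 y) (≐-refl (check 𝔹 x))
         ; (lift false) _ _ → unorderedPair-∈-introʳ (check 𝔹 y) (check 𝔹 x) (check 𝔹 y) (≐-refl (check 𝔹 y)) })
      (λ { (lift true)  _ _ → ∈-intro (check 𝔹 x) (check 𝔹 (unorderedPair x y)) (lift true)  ≤⊤ (≐-refl (check 𝔹 x))
         ; (lift false) _ _ → ∈-intro (check 𝔹 y) (check 𝔹 (unorderedPair x y)) (lift false) ≤⊤ (≐-refl (check 𝔹 y)) })

  check-orderedPair : ∀ {p} x y →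
    p ≤ check 𝔹 (orderedPair x y) ≐ orderedPairName 𝔹 (check 𝔹 x) (check 𝔹 y)
  check-orderedPair x y = ≐-trans
    (check 𝔹 (orderedPair x y))
    (unorderedPairName 𝔹 (check 𝔹 (unorderedPair x x)) (check 𝔹 (unorderedPair x y)))
    (orderedPairName 𝔹 (check 𝔹 x) (check 𝔹 y))
    (check-unorderedPair (unorderedPair x x) (unorderedPair x y))
    (unorderedPair-cong
      (check 𝔹 (unorderedPair x x)) (unorderedPairName 𝔹 (check 𝔹 x) (check 𝔹 x))
      (check 𝔹 (unorderedPair x y)) (unorderedPairName 𝔹 (check 𝔹 x) (check 𝔹 y))
      (check-unorderedPair x x) (check-unorderedPair x y))

  private
    ⟅_,_⟆ : Name 𝔹 → Name 𝔹 → Name 𝔹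
    ⟅_,_⟆ = unorderedPairName 𝔹

  unorderedPair-∈ˡ : ∀ {p} σ τ σ′ τ′ → p ≤ ⟅ σ , τ ⟆ ≐ ⟅ σ′ , τ′ ⟆ → p ≤ σ ∈ ⟅ σ′ , τ′ ⟆
  unorderedPair-∈ˡ σ τ σ′ τ′ h = ≐-elimˡ ⟅ σ , τ ⟆ ⟅ σ′ , τ′ ⟆ h (lift true) ≤⊤

  unorderedPair-∈ʳ : ∀ {p} σ τ σ′ τ′ → p ≤ ⟅ σ , τ ⟆ ≐ ⟅ σ′ , τ′ ⟆ → p ≤ τ ∈ ⟅ σ′ , τ′ ⟆
  unorderedPair-∈ʳ σ τ σ′ τ′ h = ≐-elimˡ ⟅ σ , τ ⟆ ⟅ σ′ , τ′ ⟆ h (lift false) ≤⊤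

  orderedPair-injectiveˡ : ∀ {p} σ τ σ′ τ′ →
    p ≤ orderedPairName 𝔹 σ τ ≐ orderedPairName 𝔹 σ′ τ′ → p ≤ σ ≐ σ′
  orderedPair-injectiveˡ σ τ σ′ τ′ h =
    unorderedPair-∈-elim ⟅ σ , σ ⟆ ⟅ σ′ , σ′ ⟆ ⟅ σ′ , τ′ ⟆
      (unorderedPair-∈ˡ ⟅ σ , σ ⟆ ⟅ σ , τ ⟆ ⟅ σ′ , σ′ ⟆ ⟅ σ′ , τ′ ⟆ h)
      (λ _ e → unorderedPair-∈-elim σ σ′ σ′ (unorderedPair-∈ˡ σ σ σ′ σ′ e) (λ _ z → z) (λ _ z → z))
      (λ _ e → unorderedPair-∈-elim σ′ σ σ (unorderedPair-∈ˡ σ′ τ′ σ σ (≐-sym ⟅ σ , σ ⟆ ⟅ σ′ , τ′ ⟆ e))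
        (λ _ → ≐-sym σ′ σ) (λ _ → ≐-sym σ′ σ))

  orderedPair-injectiveʳ : ∀ {p} σ τ σ′ τ′ →
    p ≤ orderedPairName 𝔹 σ τ ≐ orderedPairName 𝔹 σ′ τ′ → p ≤ τ ≐ τ′
  orderedPair-injectiveʳ {p} σ τ σ′ τ′ h =
    unorderedPair-∈-elim ⟅ σ , τ ⟆ ⟅ σ′ , σ′ ⟆ ⟅ σ′ , τ′ ⟆
      (unorderedPair-∈ʳ ⟅ σ , σ ⟆ ⟅ σ , τ ⟆ ⟅ σ′ , σ′ ⟆ ⟅ σ′ , τ′ ⟆ h)
      (λ q≤p e → degenerate q≤p
        (unorderedPair-∈-elim τ σ′ σ′ (unorderedPair-∈ʳ σ τ σ′ σ′ e) (λ _ z → z) (λ _ z → z)))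
      (λ q≤p e → unorderedPair-∈-elim τ σ′ τ′ (unorderedPair-∈ʳ σ τ σ′ τ′ e)
        (λ r≤q → degenerate (≤-trans r≤q q≤p))
        (λ _ z → z))
    where
    -- If `τ` equals `σ′`, the pair of `σ′` and `τ′` is looked up on the left side. This makes `τ′`
    -- equal to `τ` or to `σ`, and in the latter case all four names coincide.
    degenerate : ∀ {q} → q ≤ p → q ≤ τ ≐ σ′ → q ≤ τ ≐ τ′
    degenerate {q} q≤p τ≐σ′ =
      unorderedPair-∈-elim ⟅ σ′ , τ′ ⟆ ⟅ σ , σ ⟆ ⟅ σ , τ ⟆
        (unorderedPair-∈ʳ ⟅ σ′ , σ′ ⟆ ⟅ σ′ , τ′ ⟆ ⟅ σ , σ ⟆ ⟅ σ , τ ⟆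
          (≐-sym ⟅ ⟅ σ , σ ⟆ , ⟅ σ , τ ⟆ ⟆ ⟅ ⟅ σ′ , σ′ ⟆ , ⟅ σ′ , τ′ ⟆ ⟆ (≤-trans q≤p h)))
        (λ r≤q e → unorderedPair-∈-elim τ′ σ σ (unorderedPair-∈ʳ σ′ τ′ σ σ e)
          (λ s≤r → via-σ (≤-trans s≤r r≤q)) (λ s≤r → via-σ (≤-trans s≤r r≤q)))
        (λ r≤q e → unorderedPair-∈-elim τ′ σ τ (unorderedPair-∈ʳ σ′ τ′ σ τ e)
          (λ s≤r → via-σ (≤-trans s≤r r≤q)) (λ _ → ≐-sym τ′ τ))
      where
      via-σ : ∀ {r} → r ≤ q → r ≤ τ′ ≐ σ → r ≤ τ ≐ τ′
      via-σ r≤q τ′≐σ = ≐-trans τ σ′ τ′ (≤-trans r≤q τ≐σ′)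
        (≐-trans σ′ σ τ′
          (≐-sym σ σ′ (orderedPair-injectiveˡ σ τ σ′ τ′ (≤-trans r≤q (≤-trans q≤p h))))
          (≐-sym τ′ σ τ′≐σ))

  mixture : {D : Set ℓ} → (D → Carrier) → (D → Name 𝔹) → Name 𝔹
  mixture {D} w s = name (Σ D (Index ∘ s)) (λ (d , i) → element (s d) i) (λ (d , i) → w d ∧ value (s d) i)

  -- The mixing lemma. Weights may overlap where the names agree, which serves antichains, disjoint
  -- weights and the weights `asPart` alike.
  mixture-≐ : {D : Set ℓ} (w : D → Carrier) (s : D → Name 𝔹) →
    (∀ d d′ {q} → q ≤ w d → q ≤ w d′ → q ≤ s d ≐ s d′) → ∀ d {p} → p ≤ w d → p ≤ mixture w s ≐ s d
  mixture-≐ w s compat d {p} p≤w = ≐-intro (mixture w s) (s d)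
    (λ (d′ , i) q≤p q≤ →
      ≐-elimˡ (s d′) (s d) (compat d′ d (∧-fst q≤) (≤-trans q≤p p≤w)) i (∧-snd q≤))
    (λ i q≤p q≤b → ∈-intro (element (s d) i) (mixture w s) (d , i)
      (∧-greatest (≤-trans q≤p p≤w) q≤b) (≐-refl (element (s d) i)))

-- Absoluteness of check names and disjoint weights

module _ (em : ∀ {a} → ExcludedMiddle a) {ℓ : Level} (𝔹 : CompleteBooleanAlgebra ℓ) where
  open CompleteBooleanAlgebra 𝔹
  open Forcing 𝔹

  -- A nonzero condition forcing the equation is compatible, for each member of `x`, with equality
  -- to some member of `y`. The nonzero meet found there is the condition for the recursive call.
  check-≃-reflect : ∀ {p} x y → p ≤ check 𝔹 x ≐ check 𝔹 y → p ≤ ⊥ ⊎ x ≃ y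
  check-≃-reflect {p} x y h with em {P = p ≤ ⊥}
  ... | yes p≤⊥ = inj₁ p≤⊥
  ... | no p≰⊥ = inj₂ (reflect x y p p≰⊥ h)
    where
    find : ∀ {p} {K : Set ℓ} (F : K → Carrier) → Not (p ≤ ⊥) → p ≤ ⋁ F → ∃[ k ] Not (p ∧ F k ≤ ⊥)
    find {p} F p≰⊥ h with em {P = ∃[ k ] Not (p ∧ F k ≤ ⊥)}
    ... | yes found = found
    ... | no none = contradiction
      (⋁-elim h λ k q≤p q≤F → ≤-trans (∧-greatest q≤p q≤F) (null k)) p≰⊥
      where
      null : ∀ k → p ∧ F k ≤ ⊥
      null k with em {P = p ∧ F k ≤ ⊥}
      ... | yes z = z
      ... | no z = contradiction (k , z) none

    reflect : ∀ x y p → Not (p ≤ ⊥) → p ≤ check 𝔹 x ≐ check 𝔹 y → x ≃ y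
    reflect (sup I x) (sup K y) p p≰⊥ h =
      (λ i → let (k , nonzero) = find _ p≰⊥ (≐-elimˡ (check 𝔹 (sup I x)) (check 𝔹 (sup K y)) h i ≤⊤) in
        k , reflect (x i) (y k) _ nonzero (∧-snd (x∧y≤y _ _))) ,
      (λ k → let (i , nonzero) = find _ p≰⊥ (≐-elimʳ (check 𝔹 (sup I x)) (check 𝔹 (sup K y)) h k ≤⊤) in
        i , reflect (x i) (y k) _ nonzero (≐-sym (check 𝔹 (y k)) (check 𝔹 (x i)) (∧-snd (x∧y≤y _ _))))

  -- Weights can be made disjoint by removing from each the earlier ones in a well-order.
  module Disjoint (choice : Choice ℓ) {J : Set ℓ} (w : J → Carrier) where
    open WellOrder em choice J

    earlier disjoint : J → Carrier
    earlier k = ⋁ {I = ∃[ i ] i ≺ k} (λ (i , _) → w i)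
    disjoint k = w k ∧ ¬ earlier k

    disjoint-≤ : ∀ k → disjoint k ≤ w k
    disjoint-≤ k = x∧y≤x _ _

    disjoint-≡ : ∀ i k {q} → q ≤ disjoint i → q ≤ disjoint k → i ≡ k ⊎ q ≤ ⊥
    disjoint-≡ i k q≤i q≤k with ≺-connex i k
    ... | inj₁ i≡k = inj₁ i≡k
    ... | inj₂ (inj₁ i≺k) = inj₂ (¬-elim (∧-snd q≤k) (⋁-intro (i , i≺k) (∧-fst q≤i)))
    ... | inj₂ (inj₂ k≺i) = inj₂ (¬-elim (∧-snd q≤i) (⋁-intro (k , k≺i) (∧-fst q≤k)))

    -- Well-founded induction: what `w k` shares with `earlier k` is covered through earlier
    -- weights, and the rest is `disjoint k`.
    ≤-⋁-disjoint : ∀ k {p} → p ≤ w k → p ≤ ⋁ disjoint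
    ≤-⋁-disjoint k = go k (≺-wellFounded k)
      where
      go : ∀ k → Acc _≺_ k → ∀ {p} → p ≤ w k → p ≤ ⋁ disjoint
      go k (acc rs) p≤w = ∨-elim (∨-complement-intro (earlier k))
        (λ q≤p q≤earlier → ⋁-elim q≤earlier λ (i , i≺k) _ → go i (rs i≺k))
        (λ q≤p q≤¬earlier → ⋁-intro k (∧-greatest (≤-trans q≤p p≤w) q≤¬earlier))

    ⋁-≤-⋁-disjoint : ⋁ w ≤ ⋁ disjoint
    ⋁-≤-⋁-disjoint = ⋁-elim ≤-refl λ k _ → ≤-⋁-disjoint k

-- Reduced Boolean-valued models

module _ {ℓ : Level} (𝔹 : CompleteBooleanAlgebra ℓ) where
  open CompleteBooleanAlgebra 𝔹 hiding (refl; sym; trans)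
  open Forcing 𝔹

  record IsFilter (H : Pred Carrier ℓ) : Set ℓ where
    field
      upward : ∀ {x y} → x ≤ y → H x → H y
      meet   : ∀ {x y} → H x → H y → H (x ∧ y)

    deduce₂ : ∀ {x y z} → (∀ {p} → p ≤ x → p ≤ y → p ≤ z) → H x → H y → H z
    deduce₂ h hx hy = upward (h (x∧y≤x _ _) (x∧y≤y _ _)) (meet hx hy)

  part : (τ : Name 𝔹) → (Index τ → Carrier) → Name 𝔹
  part τ w = mixture w (element τ)

  module Reduced {H : Pred Carrier ℓ} (filter : IsFilter H) where
    open IsFilter filter

    infix 4 _ε_ _≋_
    _ε_ _≋_ : Rel (Name 𝔹) ℓ
    σ ε τ = H (σ ∈ τ)
    σ ≋ τ = H (σ ≐ τ)

    ≋-sym : ∀ σ τ → σ ≋ τ → τ ≋ σ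
    ≋-sym σ τ = upward (≐-sym σ τ ≤-refl)

    ε-respˡ : ∀ σ τ υ → σ ≋ τ → σ ε υ → τ ε υ
    ε-respˡ σ τ υ = deduce₂ (∈-respˡ σ τ υ)

    ε-respʳ : ∀ σ τ υ → τ ≋ υ → σ ε τ → σ ε υ
    ε-respʳ σ τ υ = deduce₂ (∈-respʳ σ τ υ)

    CollapsesTo-resp-≋ : ∀ σ τ x → σ ≋ τ → CollapsesTo _ε_ σ x → CollapsesTo _ε_ τ x
    CollapsesTo-resp-≋ σ τ x σ≋τ = CollapsesTo-resp-ext _ε_
      (λ {n} → ε-respʳ n σ τ σ≋τ) (λ {n} → ε-respʳ n τ σ (≋-sym σ τ σ≋τ)) x

    HasCollapse : Pred (Name 𝔹) (suc ℓ)
    HasCollapse σ = ∃[ x ] CollapsesTo _ε_ σ x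

    HasCollapse-resp-≋ : ∀ σ τ → σ ≋ τ → HasCollapse σ → HasCollapse τ
    HasCollapse-resp-≋ σ τ σ≋τ (x , c) = x , CollapsesTo-resp-≋ σ τ x σ≋τ c

    -- Every member of τ equals one of the small family of its parts, so _ε_ is set-like.
    asPart : Name 𝔹 → (τ : Name 𝔹) → Index τ → Carrier
    asPart n τ k = value τ k ∧ n ≐ element τ k

    ∈-≤-≐-part : ∀ n τ → n ∈ τ ≤ n ≐ part τ (asPart n τ)
    ∈-≤-≐-part n τ = ∈-elim n τ ≤-refl λ k q≤ q≤v n≐tk →
      ≐-trans n (element τ k) (part τ w) n≐tk
        (≐-sym (part τ w) (element τ k)
          (mixture-≐ w (element τ)
            (λ d d′ q≤d q≤d′ → ≐-trans (element τ d) n (element τ d′)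
              (≐-sym n (element τ d) (∧-snd q≤d)) (∧-snd q≤d′))
            k (∧-greatest q≤v n≐tk)))
      where
      w = asPart n τ

    -- Weight functions form a small type, whereas names do not, so the collapse can be a `sup` over
    -- weights; `asPart` shows that no member is missed.
    hasCollapse : ∀ τ → (∀ w → part τ w ε τ → HasCollapse (part τ w)) → HasCollapse τ
    hasCollapse τ h = sup (∃[ w ] part τ w ε τ) (λ (w , e) → proj₁ (h w e)) ,
      (λ n nετ →
        let w = asPart n τ
            n≋w = upward (∈-≤-≐-part n τ) nετ
            wετ = ε-respˡ n (part τ w) τ n≋w nετ
        in (w , wετ) ,
           CollapsesTo-resp-≋ (part τ w) n (proj₁ (h w wετ)) (≋-sym n (part τ w) n≋w) (proj₂ (h w wετ))) ,
      (λ (w , e) → part τ w , e , proj₂ (h w e))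

    acc⇒HasCollapse : ∀ {τ} → Acc _ε_ τ → HasCollapse τ
    acc⇒HasCollapse {τ} (acc rs) = hasCollapse τ λ w e → acc⇒HasCollapse (rs e)

-- Excluded middle for a Σ-type yields a witness as soon as there is one, so it acts as a choice
-- function. The result need not respect any equality on `D`; `y₀` fills the places without a
-- witness.
choose : (∀ {a} → ExcludedMiddle a) → ∀ {d y p} {D : Set d} {Y : Set y} → Y → (P : D → Y → Set p) →
         ∃[ f ] ∀ d → ∃ (P d) → P d (f d)
choose em {D = D} {Y} y₀ P = (λ d → proj₁ (value d)) , (λ d → proj₂ (value d))
  where
  value : ∀ d → Σ[ y ∈ Y ] (∃ (P d) → P d y)
  value d with em {P = ∃ (P d)}
  ... | yes (y , p) = y , λ _ → p
  ... | no none = y₀ , λ some → contradiction some none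

-- Antichains and ultrapowers

module Ultrapower (em : ∀ {a} → ExcludedMiddle a) {ℓ : Level} (choice : Choice ℓ)
                  (𝔹 : CompleteBooleanAlgebra ℓ) (U : Ultrafilter 𝔹) where
  open CompleteBooleanAlgebra 𝔹 hiding (refl; sym; trans)
  open Forcing 𝔹
  open Ultrafilter U using (⊤-mem; ⊥-nonmem; up; ∧-mem; ultra) renaming (member to _∈U)
  private module ≈ = Setoid setoid

  U-filter : IsFilter 𝔹 _∈U
  U-filter = record { upward = up _ _ ; meet = ∧-mem _ _ }

  open IsFilter U-filter using () renaming (upward to U-up; deduce₂ to U-deduce₂) public

  module Representatives (A : MaximalAntichain 𝔹) where
    open MaximalAntichain A using (Elem; elemSetoid; isAntichain; maximal; asSet) renaming (member to _∈A)
    open IsAntichain isAntichain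

    private
      rep : Elem → Elem
      rep = proj₁ (choice elemSetoid)

      rep-≈ : ∀ a → proj₁ (rep a) ≈ proj₁ a
      rep-≈ = proj₁ (proj₂ (choice elemSetoid))

      rep-cong : ∀ a a′ → proj₁ a ≈ proj₁ a′ → rep a ≡ rep a′
      rep-cong = proj₂ (proj₂ (choice elemSetoid))

    -- A acts as a setoid; one representative of each of its points avoids congruence conditions.
    D : Set ℓ
    D = ∃[ a ] rep a ≡ a

    private
      D-≡ : {d d′ : D} → proj₁ d ≡ proj₁ d′ → d ≡ d′
      D-≡ {a , p} {.a , q} refl = cong (a ,_) (uip p q)

    ι : D → Elem
    ι = proj₁

    e : D → Carrier
    e d = proj₁ (ι d)

    ρ : Elem → D
    ρ a = rep a , rep-cong (rep a) a (rep-≈ a)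

    ρ-≈ : ∀ a → e (ρ a) ≈ proj₁ a
    ρ-≈ = rep-≈

    ρ-cong : ∀ a a′ → proj₁ a ≈ proj₁ a′ → ρ a ≡ ρ a′
    ρ-cong a a′ a≈a′ = D-≡ (rep-cong a a′ a≈a′)

    ρ-ι : ∀ d → ρ (ι d) ≡ d
    ρ-ι (a , p) = D-≡ p

    e-injective : ∀ d d′ → e d ≈ e d′ → d ≡ d′
    e-injective d d′ ed≈ed′ = subst (_≡ d′) (ρ-ι d) (subst (ρ (ι d) ≡_) (ρ-ι d′) (ρ-cong (ι d) (ι d′) ed≈ed′))

    e-disjoint : ∀ d d′ {q} → q ≤ e d → q ≤ e d′ → d ≡ d′ ⊎ q ≤ ⊥
    e-disjoint d d′ q≤d q≤d′ with em {P = e d ≈ e d′}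
    ... | yes ed≈ed′ = inj₁ (e-injective d d′ ed≈ed′)
    ... | no ed≉ed′ = inj₂ (≤-trans (∧-greatest q≤d q≤d′)
      (≤-reflexive (incompatible (e d) (e d′) (proj₂ (ι d)) (proj₂ (ι d′)) ed≉ed′)))

    -- If the complement of ⋁ e were nonzero, it could be added to the antichain.
    e-cover : ∀ {p} → p ≤ ⋁ e
    e-cover = ∨-elim (∨-complement-intro (⋁ e)) (λ _ h → h) (λ _ q≤c → ≤-trans q≤c c≤⋁e)
      where
      c = ¬ ⋁ e

      ≤⋁e : ∀ a → a ∈A → a ≤ ⋁ e
      ≤⋁e a a∈A = ⋁-intro (ρ (a , a∈A)) (≤-reflexive (≈.sym (ρ-≈ (a , a∈A))))

      c≤⋁e : c ≤ ⋁ e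
      c≤⋁e with em {P = c ≈ ⊥}
      ... | yes c≈⊥ = ≤-trans (≤-reflexive c≈⊥) ⊥≤
      ... | no c≉⊥ = ≤⋁e c (maximal (λ b → b ∈A ⊎ b ≈ c) extended inj₁ (inj₂ ≈.refl))
        where
        apart : ∀ a b → a ∈A → b ≈ c → a ∧ b ≈ ⊥
        apart a b a∈A b≈c = ≤-antisym
          (¬-elim (≤-trans (x∧y≤y a b) (≤-reflexive b≈c)) (≤-trans (x∧y≤x a b) (≤⋁e a a∈A))) ⊥≤

        extended : IsAntichain 𝔹 (λ b → b ∈A ⊎ b ≈ c)
        extended = record
          { resp = λ { x≈y (inj₁ x∈A) → inj₁ (resp x≈y x∈A)
                     ; x≈y (inj₂ x≈c) → inj₂ (≈.trans (≈.sym x≈y) x≈c) }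
          ; nonzero = λ { b (inj₁ b∈A) → nonzero b b∈A
                        ; b (inj₂ b≈c) b≈⊥ → c≉⊥ (≈.trans (≈.sym b≈c) b≈⊥) }
          ; incompatible = λ
            { a b (inj₁ a∈A) (inj₁ b∈A) → incompatible a b a∈A b∈A
            ; a b (inj₁ a∈A) (inj₂ b≈c) _ → apart a b a∈A b≈c
            ; a b (inj₂ a≈c) (inj₁ b∈A) _ → ≈.trans (∧-comm a b) (apart b a b∈A a≈c)
            ; a b (inj₂ a≈c) (inj₂ b≈c) a≉b → contradiction (≈.trans a≈c (≈.sym b≈c)) a≉b
            }
          }

    mixture-e : (s : D → Name 𝔹) → ∀ d {p} → p ≤ e d → p ≤ mixture e s ≐ s d
    mixture-e s = mixture-≐ e s compat
      where
      compat : ∀ d d′ {q} → q ≤ e d → q ≤ e d′ → q ≤ s d ≐ s d′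
      compat d d′ q≤d q≤d′ with e-disjoint d d′ q≤d q≤d′
      ... | inj₁ refl = ≐-refl (s d)
      ... | inj₂ q≤⊥ = ≤-trans q≤⊥ ⊥≤

    -- `True (em {P = X d})` turns a predicate of any level into a small one, so that the index type
    -- fits `⋁`.
    join : ∀ {a} → Pred D a → Carrier
    join X = ⋁ {I = ∃[ d ] True (em {P = X d})} (λ (d , _) → e d)

    join-intro : ∀ {a} (X : Pred D a) {p} d → X d → p ≤ e d → p ≤ join X
    join-intro X d xd = ⋁-intro (d , fromWitness xd)

    join-elim : ∀ {a} (X : Pred D a) {p z} → p ≤ join X →
                (∀ d → X d → ∀ {q} → q ≤ p → q ≤ e d → q ≤ z) → p ≤ z
    join-elim X p≤ h = ⋁-elim p≤ λ (d , xd) → h d (toWitness xd)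

    -- X belongs to U_A, for a set X of elements of the antichain.
    AE : ∀ {a} → Pred D a → Set ℓ
    AE X = join X ∈U

    AE-map : ∀ {a b} {X : Pred D a} {Y : Pred D b} → (∀ d → X d → Y d) → AE X → AE Y
    AE-map {X = X} {Y} h = U-up (join-elim X ≤-refl λ d xd _ → join-intro Y d (h d xd))

    AE-map₂ : ∀ {a b c} {X : Pred D a} {Y : Pred D b} {Z : Pred D c} →
              (∀ d → X d → Y d → Z d) → AE X → AE Y → AE Z
    AE-map₂ {X = X} {Y} {Z} h = U-deduce₂ λ q≤X q≤Y →
      join-elim X q≤X λ d xd r≤q r≤e →
      join-elim Y (≤-trans r≤q q≤Y) λ d′ yd′ s≤r s≤e′ → both d d′ xd yd′ (≤-trans s≤r r≤e) s≤e′
      where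
      both : ∀ d d′ → X d → Y d′ → ∀ {r} → r ≤ e d → r ≤ e d′ → r ≤ join Z
      both d d′ xd yd′ r≤e r≤e′ with e-disjoint d d′ r≤e r≤e′
      ... | inj₁ refl = join-intro Z d (h d xd yd′) r≤e
      ... | inj₂ r≤⊥ = ≤-trans r≤⊥ ⊥≤

    AE-⊎-¬ : ∀ {a} (X : Pred D a) → AE X ⊎ AE (λ d → Not X d)
    AE-⊎-¬ X with ultra (join X)
    ... | inj₁ aeX = inj₁ aeX
    ... | inj₂ ¬join = inj₂ (U-up (⋁-elim e-cover other) ¬join)
      where
      other : ∀ d {q} → q ≤ ¬ join X → q ≤ e d → q ≤ join (λ d → Not X d)
      other d q≤¬ q≤e with em {P = X d}
      ... | yes xd = ¬-elim q≤¬ (join-intro X d xd q≤e)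
      ... | no ¬xd = join-intro (λ d → Not X d) d ¬xd q≤e

    -- Łoś's theorem for implication: by `AE-⊎-¬`, the premise holds almost everywhere or the
    -- implication is vacuous almost everywhere.
    AE-→ : ∀ {a b} {X : Pred D a} {Y : Pred D b} → (AE X → AE Y) → AE (λ d → X d → Y d)
    AE-→ {X = X} h with AE-⊎-¬ X
    ... | inj₁ aeX = AE-map (λ _ y _ → y) (h aeX)
    ... | inj₂ ae¬X = AE-map (λ _ ¬x x → contradiction x ¬x) ae¬X

    -- Łoś's theorem for the universal quantifier: `Q` is tested on a function picking a
    -- counterexample wherever one exists.
    AE-∀ : ∀ {y q} {Y : Set y} → Y → (Q : D → Y → Set q) →
           (∀ f → AE (λ d → Q d (f d))) → AE (λ d → ∀ y → Q d y)
    AE-∀ y₀ Q h = AE-map (λ d qf y → everywhere d qf y) (h f)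
      where
      f = proj₁ (choose em y₀ (λ d y → Not Q d y))

      everywhere : ∀ d → Q d (f d) → ∀ y → Q d y
      everywhere d qf y with em {P = Q d y}
      ... | yes qy = qy
      ... | no ¬qy = contradiction qf (proj₂ (choose em y₀ (λ d y → Not Q d y)) d (y , ¬qy))

    infixl 9 _at_
    _at_ : FunctionOn 𝔹 A → D → V ℓ
    f at d = Func.to f (ι d)

    extend : (D → V ℓ) → FunctionOn 𝔹 A
    extend f = record
      { to = f ∘ ρ
      ; cong = λ {a} {a′} a≈a′ → subst (λ d → f (ρ a) ≃ f d) (ρ-cong a a′ a≈a′) (≃-refl (f (ρ a)))
      }

    extend-at : ∀ f d → extend f at d ≡ f d
    extend-at f d = cong f (ρ-ι d)

    at-ρ : ∀ f a → f at ρ a ≃ Func.to f a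
    at-ρ f a = Func.cong f (ρ-≈ a)

    private
      _εᴬ_ : Rel (FunctionOn 𝔹 A) ℓ
      _εᴬ_ = E[_] 𝔹 U A

    ε⇒AE : ∀ f g → f εᴬ g → AE (λ d → f at d ∈V g at d)
    ε⇒AE f g = U-up (⋁-elim ≤-refl λ (a , fa∈ga) _ q≤a →
      join-intro (λ d → f at d ∈V g at d) (ρ a)
        (∈V-respˡ (g at ρ a) (at-ρ f a)
          (∈V-respʳ (Func.to f a) (Func.to g a) (g at ρ a) (≃-sym (g at ρ a) (Func.to g a) (at-ρ g a)) fa∈ga))
        (≤-trans q≤a (≤-reflexive (≈.sym (ρ-≈ a)))))

    AE⇒ε : ∀ f g → AE (λ d → f at d ∈V g at d) → f εᴬ g
    AE⇒ε f g = U-up (join-elim (λ d → f at d ∈V g at d) ≤-refl λ d fd∈gd _ → ⋁-intro (ι d , fd∈gd))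

    CollapsesTo-resp-AE : ∀ f g x → AE (λ d → f at d ≃ g at d) → CollapsesTo _εᴬ_ f x → CollapsesTo _εᴬ_ g x
    CollapsesTo-resp-AE f g x f≃g = CollapsesTo-resp-ext _εᴬ_
      (λ {n} nεf → AE⇒ε n g (AE-map₂ (λ d → ∈V-respʳ (n at d) (f at d) (g at d)) f≃g (ε⇒AE n f nεf)))
      (λ {n} nεg → AE⇒ε n f (AE-map₂ (λ d e → ∈V-respʳ (n at d) (g at d) (f at d) (≃-sym (f at d) (g at d) e))
                               f≃g (ε⇒AE n g nεg)))
      x

    -- Extensionality of the ultrapower, by induction on `x`. A function `h` picking members of `f`
    -- is itself a point, so it collapses to some `x i`, which is also the collapse of a member of
    -- `g`.
    CollapsesTo-injective : ∀ f g x → CollapsesTo _εᴬ_ f x → CollapsesTo _εᴬ_ g x → AE (λ d → f at d ≃ g at d)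
    CollapsesTo-injective f g x cf cg =
      AE-map₂ (λ d → ∈V-ext (f at d) (g at d)) (included f g x cf cg) (included g f x cg cf)
      where
      included : ∀ f g x → CollapsesTo _εᴬ_ f x → CollapsesTo _εᴬ_ g x →
                 AE (λ d → ∀ z → z ∈V f at d → z ∈V g at d)
      included f g (sup I x) (p , _) (_ , q) = AE-∀ ∅V _ λ h → AE-→ λ h∈f →
        let h∈f′ = AE⇒ε (extend h) f (AE-map (λ d → subst (_∈V f at d) (sym (extend-at h d))) h∈f)
            i , c = p (extend h) h∈f′
            n , nεg , c′ = q i
        in AE-map₂
             (λ d e n∈g → subst (_∈V g at d) (extend-at h d) (∈V-respˡ (g at d) e n∈g))
             (CollapsesTo-injective (extend h) n (x i) c c′) (ε⇒AE n g nεg)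

    -- j(f)(b_A) is the mixture of the names of the values of f.
    module _ (f : FunctionOn 𝔹 A) where
      private
        pair : Elem → V ℓ
        pair a = orderedPair (code (proj₁ a)) (Func.to f a)

        point image : Elem → Name 𝔹
        point a = check 𝔹 (code (proj₁ a))
        image a = check 𝔹 (Func.to f a)

      -- Locally, `β` is the code of a condition `b` in the generic filter and the code of an
      -- element `a` of the antichain. Codes are injective, so `b` and `a` agree and the graph is
      -- evaluated below `a`.
      Is-π∞⇒∈U : ∀ σ → Is-π∞ 𝔹 U A f σ → ⋁ (λ d → e d ∧ σ ≐ check 𝔹 (f at d)) ∈U
      Is-π∞⇒∈U σ (β , (_ , β∈Ġ) , ⟨β,σ⟩∈f) = U-deduce₂ forced β∈Ġ ⟨β,σ⟩∈f
        where
        z = ⋁ (λ d → e d ∧ σ ≐ check 𝔹 (f at d))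

        forced′ : ∀ a b {q} → q ≤ b → q ≤ β ≐ check 𝔹 (code b) → q ≤ β ≐ point a → q ≤ σ ≐ image a → q ≤ z
        forced′ a b {q} q≤b β≐b β≐a σ≐fa = [ (λ q≤⊥ → ≤-trans q≤⊥ ⊥≤) , (λ cb≃ca → ⋁-intro (ρ a) (∧-greatest
          (≤-trans q≤b (≤-reflexive (≈.trans (Equivalence.from (code-≃ b (proj₁ a)) cb≃ca) (≈.sym (ρ-≈ a)))))
          (≐-trans σ (image a) (check 𝔹 (f at ρ a)) σ≐fa
            (check-≃ (Func.to f a) (f at ρ a) (≃-sym (f at ρ a) (Func.to f a) (at-ρ f a)))))) ]′
          (check-≃-reflect em 𝔹 {q} (code b) (code (proj₁ a))
            (≐-trans (check 𝔹 (code b)) β (point a) (≐-sym β (check 𝔹 (code b)) β≐b) β≐a))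

        forced : ∀ {q} → q ≤ β ∈ Ġ 𝔹 → q ≤ orderedPairName 𝔹 β σ ∈ check 𝔹 (graph 𝔹 A f) → q ≤ z
        forced {q} q≤Ġ q≤f =
          check-∈-elim {q} {z} (orderedPairName 𝔹 β σ) Elem pair q≤f λ a {r} r≤q r≤pair →
          let r≤pair′ = ≐-trans {r} (orderedPairName 𝔹 β σ) (check 𝔹 (pair a)) (orderedPairName 𝔹 (point a) (image a))
                          r≤pair (check-orderedPair (code (proj₁ a)) (Func.to f a))
              β≐a = orderedPair-injectiveˡ {r} β σ (point a) (image a) r≤pair′
              σ≐fa = orderedPair-injectiveʳ {r} β σ (point a) (image a) r≤pair′
          in ∈-elim {r} {z} β (Ġ 𝔹) (≤-trans r≤q q≤Ġ) λ b s≤r s≤b β≐b →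
             forced′ a b s≤b β≐b (≤-trans s≤r β≐a) (≤-trans s≤r σ≐fa)

      mixture-Is-π∞ : Is-π∞ 𝔹 U A f (mixture e (image ∘ ι))
      mixture-Is-π∞ = β , (U-up inA ⊤-mem , U-up inG ⊤-mem) , U-up inGraph ⊤-mem
        where
        β = mixture e (point ∘ ι)
        σ = mixture e (image ∘ ι)

        inA : ⊤ ≤ β ∈ check 𝔹 asSet
        inA = ⋁-elim e-cover λ d _ q≤e → check-∈-intro β Elem (code ∘ proj₁) (ι d) (mixture-e (point ∘ ι) d q≤e)

        inG : ⊤ ≤ β ∈ Ġ 𝔹
        inG = ⋁-elim e-cover λ d _ q≤e → ∈-intro β (Ġ 𝔹) (e d) q≤e (mixture-e (point ∘ ι) d q≤e)

        inGraph : ⊤ ≤ orderedPairName 𝔹 β σ ∈ check 𝔹 (graph 𝔹 A f)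
        inGraph = ⋁-elim e-cover λ d {q} _ q≤e → check-∈-intro {q} (orderedPairName 𝔹 β σ) Elem pair (ι d)
          (≐-trans {q} (orderedPairName 𝔹 β σ) (orderedPairName 𝔹 (point (ι d)) (image (ι d))) (check 𝔹 (pair (ι d)))
            (orderedPair-cong β (point (ι d)) σ (image (ι d))
              (mixture-e (point ∘ ι) d q≤e) (mixture-e (image ∘ ι) d q≤e))
            (≐-sym (check 𝔹 (pair (ι d))) (orderedPairName 𝔹 (point (ι d)) (image (ι d)))
              (check-orderedPair (code (e d)) (f at d))))

-- Simple antichains

module SimpleAntichain
  (em : ∀ {a} → ExcludedMiddle a) {ℓ : Level} (choice : Choice ℓ)
  (𝔹 : CompleteBooleanAlgebra ℓ) (U : Ultrafilter 𝔹) (wellFounded : WellFounded (_E_ 𝔹 U))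
  (A : MaximalAntichain 𝔹) (simple : Simple 𝔹 U A) where

  open CompleteBooleanAlgebra 𝔹 hiding (refl; sym; trans)
  open Forcing 𝔹
  open Ultrafilter U using (⊤-mem; ⊥-nonmem) renaming (member to _∈U)
  open Ultrapower em choice 𝔹 U
  open Representatives A

  private
    _εᴬ_ : Rel (FunctionOn 𝔹 A) ℓ
    _εᴬ_ = E[_] 𝔹 U A

    m : FunctionOn 𝔹 A
    m = proj₁ simple

  H : D → Pred Carrier ℓ
  H d c = code c ∈V m at d

  -- The join is the Boolean value of j(k)(b_A) lying in the generic filter, so this and `Łoś-to`
  -- are the defining property of `m`, read for the function sending `d` to `code (k d)`.
  Łoś-from : (k : D → Carrier) → ⋁ (λ d → e d ∧ k d) ∈U → AE (λ d → H d (k d))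
  Łoś-from k ⋁∈U = AE-map (λ d → subst (_∈V m at d) (extend-at (code ∘ k) d))
    (ε⇒AE f m (Equivalence.from (proj₂ simple f) (σ , mixture-Is-π∞ f , U-up inG ⋁∈U)))
    where
    f = extend (code ∘ k)
    s = λ d → check 𝔹 (f at d)
    σ = mixture e s

    inG : ⋁ (λ d → e d ∧ k d) ≤ σ ∈ Ġ 𝔹
    inG = ⋁-elim ≤-refl λ d _ q≤ → ∈-intro σ (Ġ 𝔹) (k d) (∧-snd q≤)
      (subst (λ y → _ ≤ σ ≐ check 𝔹 y) (extend-at (code ∘ k) d) (mixture-e s d (∧-fst q≤)))

  Łoś-to : (k : D → Carrier) → AE (λ d → H d (k d)) → ⋁ (λ d → e d ∧ k d) ∈U
  Łoś-to k aeH = U-deduce₂ forced σ∈Ġ (Is-π∞⇒∈U f σ π)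
    where
    f = extend (code ∘ k)

    f∈G : G[_] 𝔹 U A f
    f∈G = Equivalence.to (proj₂ simple f)
      (AE⇒ε f m (AE-map (λ d → subst (_∈V m at d) (sym (extend-at (code ∘ k) d))) aeH))

    σ = proj₁ f∈G
    π = proj₁ (proj₂ f∈G)
    σ∈Ġ = proj₂ (proj₂ f∈G)

    forced : ∀ {q} → q ≤ σ ∈ Ġ 𝔹 → q ≤ ⋁ (λ d → e d ∧ σ ≐ check 𝔹 (f at d)) → q ≤ ⋁ (λ d → e d ∧ k d)
    forced {q} q≤Ġ q≤⋁ = ⋁-elim q≤⋁ λ d {r} r≤q r≤ →
      ∈-elim σ (Ġ 𝔹) (≤-trans r≤q q≤Ġ) λ b {s} s≤r s≤b σ≐b →
      [ (λ s≤⊥ → ≤-trans s≤⊥ ⊥≤)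
      , (λ cb≃ck → ⋁-intro d (∧-greatest (≤-trans s≤r (∧-fst r≤))
          (≤-trans s≤b (≤-reflexive (Equivalence.from (code-≃ b (k d)) cb≃ck)))))
      ]′ (check-≃-reflect em 𝔹 {s} (code b) (code (k d))
           (≐-trans {s} (check 𝔹 (code b)) σ (check 𝔹 (code (k d))) (≐-sym σ (check 𝔹 (code b)) σ≐b)
             (subst (λ y → s ≤ σ ≐ check 𝔹 y) (extend-at (code ∘ k) d) (≤-trans s≤r (∧-snd r≤)))))

  AE-H⇒∈U : ∀ c → AE (λ d → H d c) → c ∈U
  AE-H⇒∈U c aeH = U-up (⋁-elim ≤-refl λ _ _ → ∧-snd) (Łoś-to (λ _ → c) aeH)

  ∈U⇒AE-H : ∀ c → c ∈U → AE (λ d → H d c)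
  ∈U⇒AE-H c c∈U = Łoś-from (λ _ → c)
    (U-up (⋁-elim e-cover λ d q≤c q≤e → ⋁-intro d (∧-greatest q≤e q≤c)) c∈U)

  -- The element b_A lies in G; seen from the ultrapower, `e d` lies in `H d`.
  AE-H-above-e : (k : D → Carrier) → (∀ d → e d ≤ k d) → AE (λ d → H d (k d))
  AE-H-above-e k h = Łoś-from k
    (U-up (⋁-elim e-cover λ d _ q≤e → ⋁-intro d (∧-greatest q≤e (≤-trans q≤e (h d)))) ⊤-mem)

  AE-H-proper : AE (λ d → Not H d ⊥)
  AE-H-proper with AE-⊎-¬ (λ d → H d ⊥)
  ... | inj₁ aeH = contradiction (AE-H⇒∈U ⊥ aeH) ⊥-nonmem
  ... | inj₂ ae¬H = ae¬H

  -- Both laws are tested on functions from `D` to pairs of conditions. `Łoś-to` and `Łoś-from`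
  -- translate each test into a statement about joins in `U`, where it follows from the laws of `U`.
  AE-filter : AE (λ d → IsFilter 𝔹 (H d))
  AE-filter = AE-map₂
    (λ d up meet → record
      { upward = λ {x} {y} x≤y → up (x , y , x≤y)
      ; meet   = λ {x} {y} → meet (x , y)
      })
    (AE-∀ (⊥ , ⊥ , ≤-refl) (λ d (x , y , _) → H d x → H d y) λ f → AE-→ λ aeH →
      Łoś-from (λ d → proj₁ (proj₂ (f d)))
        (U-up (⋁-elim ≤-refl λ d _ q≤ →
          ⋁-intro d (∧-greatest (∧-fst q≤) (≤-trans (∧-snd q≤) (proj₂ (proj₂ (f d))))))
        (Łoś-to (λ d → proj₁ (f d)) aeH)))
    (AE-∀ (⊥ , ⊥) (λ d (x , y) → H d x → H d y → H d (x ∧ y)) λ f → AE-→ λ aeHx →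
      AE-→ {Y = λ d → H d (proj₁ (f d) ∧ proj₂ (f d))} λ aeHy →
      Łoś-from (λ d → proj₁ (f d) ∧ proj₂ (f d))
        (U-deduce₂ (λ q≤x q≤y →
          ⋁-elim q≤x λ d r≤q r≤x → ⋁-elim (≤-trans r≤q q≤y) λ d′ s≤r s≤y →
          both (proj₁ ∘ f) (proj₂ ∘ f) d d′ (≤-trans s≤r r≤x) s≤y)
        (Łoś-to (proj₁ ∘ f) aeHx) (Łoś-to (proj₂ ∘ f) aeHy)))
    where
    both : ∀ (x y : D → Carrier) d d′ {q} → q ≤ e d ∧ x d → q ≤ e d′ ∧ y d′ → q ≤ ⋁ (λ d → e d ∧ (x d ∧ y d))
    both x y d d′ q≤x q≤y with e-disjoint d d′ (∧-fst q≤x) (∧-fst q≤y)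
    ... | inj₁ refl = ⋁-intro d (∧-greatest (∧-fst q≤x) (∧-greatest (∧-snd q≤x) (∧-snd q≤y)))
    ... | inj₂ q≤⊥ = ≤-trans q≤⊥ ⊥≤

  -- Collapsing names inside the ultrapower

  ε : D → Rel (Name 𝔹) ℓ
  ε d σ τ = H d (σ ∈ τ)

  -- A function from `D` to names is thus almost everywhere a single name, to which facts about `U`
  -- apply.
  AE-mixture : (s : D → Name 𝔹) → AE (λ d → H d (mixture e s ≐ s d))
  AE-mixture s = AE-H-above-e (λ d → mixture e s ≐ s d) (λ d → mixture-e s d ≤-refl)

  HasCollapse : D → Pred (Name 𝔹) _
  HasCollapse d σ = ∃[ x ] CollapsesTo (ε d) σ x

  -- Induction along `_E_`. A choice of one part of `σ` for each `d` is mixed into a single name; if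
  -- the parts are members of `σ` almost everywhere, so is the mixture, and its collapses are
  -- collapses of the parts.
  AE-HasCollapse : ∀ σ → AE (λ d → HasCollapse d σ)
  AE-HasCollapse σ = go σ (wellFounded σ)
    where
    go : ∀ σ → Acc (_E_ 𝔹 U) σ → AE (λ d → HasCollapse d σ)
    go σ (acc rs) = AE-map₂ (λ d filter → Reduced.hasCollapse 𝔹 filter σ) AE-filter
      (AE-∀ (λ _ → ⊥) (λ d w → ε d (part 𝔹 σ w) σ → HasCollapse d (part 𝔹 σ w)) λ w → AE-→ λ part∈σ →
        let s = λ d → part 𝔹 σ (w d)
            ρ = mixture e s
            filter×ρ≐s = AE-map₂ (λ _ → _,_) AE-filter (AE-mixture s)
            ρ∈σ = AE-map₂ (λ d (filter , ρ≐s) →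
                      Reduced.ε-respˡ 𝔹 filter (s d) ρ σ (Reduced.≋-sym 𝔹 filter ρ (s d) ρ≐s))
                    filter×ρ≐s part∈σ
        in AE-map₂ (λ d (filter , ρ≐s) → Reduced.HasCollapse-resp-≋ 𝔹 filter ρ (s d) ρ≐s)
             filter×ρ≐s (go ρ (rs (AE-H⇒∈U (ρ ∈ σ) ρ∈σ))))

  private
    chosen : ∀ σ → ∃[ x ] ∀ d → HasCollapse d σ → CollapsesTo (ε d) σ (x d)
    chosen σ = choose em ∅V (λ d x → CollapsesTo (ε d) σ x)

  collapse : Name 𝔹 → FunctionOn 𝔹 A
  collapse σ = extend (proj₁ (chosen σ))

  collapse-spec : ∀ σ d → HasCollapse d σ → CollapsesTo (ε d) σ (collapse σ at d)
  collapse-spec σ d h =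
    subst (CollapsesTo (ε d) σ) (sym (extend-at (proj₁ (chosen σ)) d)) (proj₂ (chosen σ) d h)

  collapse-≃ : ∀ σ d x → CollapsesTo (ε d) σ x → collapse σ at d ≃ x
  collapse-≃ σ d x c = CollapsesTo-unique (ε d) (collapse σ at d) x (collapse-spec σ d (x , c)) c

  AE-collapse : ∀ σ → AE (λ d → CollapsesTo (ε d) σ (collapse σ at d))
  AE-collapse σ = AE-map (collapse-spec σ) (AE-HasCollapse σ)

  collapse-mono : ∀ τ σ → _E_ 𝔹 U τ σ → collapse τ εᴬ collapse σ
  collapse-mono τ σ τEσ = AE⇒ε (collapse τ) (collapse σ)
    (AE-map₂ member (AE-collapse σ) (∈U⇒AE-H (τ ∈ σ) τEσ))
    where
    member : ∀ d → CollapsesTo (ε d) σ (collapse σ at d) → ε d τ σ → collapse τ at d ∈V collapse σ at d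
    member d c τεσ = let (y , y∈ , c′) = CollapsesTo-∈ (ε d) (collapse σ at d) c τεσ in
      ∈V-respˡ (collapse σ at d) (collapse-≃ τ d y c′) y∈

  -- For almost every `d` some name `ν d` in `σ` collapses to the value of `n` at `d`; `τ` is the
  -- mixture of these names.
  collapse-members : ∀ n σ → n εᴬ collapse σ → ∃[ τ ] _E_ 𝔹 U τ σ × AE (λ d → collapse τ at d ≃ n at d)
  collapse-members n σ nεσ = τ ,
    AE-H⇒∈U (τ ∈ σ) (AE-map₂
      (λ d (filter , τ≐ν) (νεσ , _) →
        Reduced.ε-respˡ 𝔹 filter (ν d) τ σ (Reduced.≋-sym 𝔹 filter τ (ν d) τ≐ν) νεσ)
      filter×τ≐ν aeν) ,
    AE-map₂
      (λ d (filter , τ≐ν) (_ , c) → collapse-≃ τ d (n at d)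
        (Reduced.CollapsesTo-resp-≋ 𝔹 filter (ν d) τ (n at d) (Reduced.≋-sym 𝔹 filter τ (ν d) τ≐ν) c))
      filter×τ≐ν aeν
    where
    P : D → Name 𝔹 → Set _
    P d ν = ε d ν σ × CollapsesTo (ε d) ν (n at d)

    ν = proj₁ (choose em σ P)
    τ = mixture e ν

    aeν : AE (λ d → P d (ν d))
    aeν = AE-map₂ (λ d c n∈ → proj₂ (choose em σ P) d (CollapsesTo-∋ (ε d) (collapse σ at d) (n at d) c n∈))
      (AE-collapse σ) (ε⇒AE n (collapse σ) nεσ)

    filter×τ≐ν = AE-map₂ (λ _ → _,_) AE-filter (AE-mixture ν)

  -- Induction on `x`: `collapse-mono` and `collapse-members` match the members of `σ` with those of
  -- `collapse σ`.
  collapse-CollapsesTo : ∀ σ x → CollapsesTo (_E_ 𝔹 U) σ x → CollapsesTo _εᴬ_ (collapse σ) x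
  collapse-CollapsesTo σ (sup I x) (p , q) =
    (λ n nεσ → let (τ , τEσ , τ≃n) = collapse-members n σ nεσ ; (i , c) = p τ τEσ in
      i , CollapsesTo-resp-AE (collapse τ) n (x i) τ≃n (collapse-CollapsesTo τ (x i) c)) ,
    (λ i → let (τ , τEσ , c) = q i in
      collapse τ , collapse-mono τ σ τEσ , collapse-CollapsesTo τ (x i) c)

  -- Well-foundedness gives `σ` some collapse `y`; pushed forward to the ultrapower, `y` must agree
  -- with `x`.
  CollapsesTo-collapse : ∀ σ x → CollapsesTo _εᴬ_ (collapse σ) x → CollapsesTo (_E_ 𝔹 U) σ x
  CollapsesTo-collapse σ x c = let (y , c′) = Reduced.acc⇒HasCollapse 𝔹 U-filter (wellFounded σ) in
    CollapsesTo-resp-≃ (_E_ 𝔹 U) y x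
      (CollapsesTo-unique _εᴬ_ y x (collapse-CollapsesTo σ y c′) c) c′

-- Simple skeletons

module Skeleton
  (em : ∀ {a} → ExcludedMiddle a) {ℓ : Level} (choice : Choice ℓ)
  (𝔹 : CompleteBooleanAlgebra ℓ) (U : Ultrafilter 𝔹) (wellFounded : WellFounded (_E_ 𝔹 U))
  (I : Set ℓ) (𝔄 : I → MaximalAntichain 𝔹) (skeleton : IsSkeleton 𝔹 U 𝔄)
  (simple : ∀ i → Simple 𝔹 U (𝔄 i)) where

  open CompleteBooleanAlgebra 𝔹 hiding (refl; sym; trans)
  open Forcing 𝔹
  open Ultrafilter U using (⊤-mem; ⊥-nonmem; ∧-mem; ultra) renaming (member to _∈U)
  open Ultrapower em choice 𝔹 U
  open IsSkeleton skeleton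
  private
    module ≈ = Setoid setoid
    module R i = Representatives (𝔄 i)
    module S i = SimpleAntichain em choice 𝔹 U wellFounded (𝔄 i) (simple i)

    set : I → V ℓ
    set i = MaximalAntichain.asSet (𝔄 i)

    𝔄̇ : Name 𝔹
    𝔄̇ = proj₁ j[𝔄]∈

  Ground-intro : ∀ σ {J : Set ℓ} (w : J → Carrier) (x : J → V ℓ) →
                 (∀ k → w k ≤ σ ≐ check 𝔹 (x k)) → ⋁ w ∈U → Ground 𝔹 U σ
  Ground-intro σ w x h ⋁w∈U = s , isSup ,
    U-up (⋁-elim ≤-refl λ k _ q≤w → ≤-trans q≤w (≤-trans (h k) (upper (x k)))) ⋁w∈U
    where
    -- Only the values attained are collected, each with a small witness, which avoids the large
    -- index type `V ℓ`.
    s = ⋁ {I = ∃[ c ] True (em {P = ∃[ y ] σ ≐ check 𝔹 y ≈ c})} proj₁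

    upper : ∀ y → σ ≐ check 𝔹 y ≤ s
    upper y = ⋁-intro (σ ≐ check 𝔹 y , fromWitness (y , ≈.refl)) ≤-refl

    isSup : IsSupremum (λ y → σ ≐ check 𝔹 y) s
    isSup = upper , λ u ub → ⋁-elim ≤-refl λ (c , val) _ q≤c →
      let (y , σ≐y≈c) = toWitness val in ≤-trans q≤c (≤-trans (≤-reflexive (≈.sym σ≐y≈c)) (ub y))

  -- A name for a member of 𝔄̇ refuting one of the implications would be one of the j(𝔄 k).
  ⋀-∈U : (b : I → Carrier) → (∀ i k → set i ≃ set k → b i ≡ b k) → (∀ i → b i ∈U) →
         ⋀ (λ i → check 𝔹 (set i) ∈ 𝔄̇ ⇒ b i) ∈U
  ⋀-∈U b b-cong b∈U with ultra (⋀ (λ i → check 𝔹 (set i) ∈ 𝔄̇ ⇒ b i))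
  ... | inj₁ holds = holds
  ... | inj₂ fails = contradiction
    (U-deduce₂ (λ q≤b q≤¬b → ¬-elim q≤¬b q≤b) (b∈U k) (U-deduce₂ forced ⋁d∈U ν∼k)) ⊥-nonmem
    where
    w : I → Carrier
    w i = check 𝔹 (set i) ∈ 𝔄̇ ∧ ¬ b i

    open Disjoint em 𝔹 choice w

    ν = mixture disjoint (check 𝔹 ∘ set)

    ν≐ : ∀ i {q} → q ≤ disjoint i → q ≤ ν ≐ check 𝔹 (set i)
    ν≐ = mixture-≐ disjoint (check 𝔹 ∘ set) λ i k {q} q≤i q≤k →
      [ (λ i≡k → subst (λ k → q ≤ check 𝔹 (set i) ≐ check 𝔹 (set k)) i≡k (≐-refl (check 𝔹 (set i))))
      , (λ q≤⊥ → ≤-trans q≤⊥ ⊥≤) ]′ (disjoint-≡ i k q≤i q≤k)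

    ⋁d∈U : ⋁ disjoint ∈U
    ⋁d∈U = U-up ⋁-≤-⋁-disjoint (U-up
      (∨-elim (∨-complement-intro (⋁ w)) (λ _ q≤ → q≤) λ q≤¬⋀ q≤¬⋁ →
        ¬-elim q≤¬⋀ (⋀-intro λ i → ⇒-intro λ r≤q r≤∈ → ¬¬-elim (¬-intro λ s≤r s≤¬b →
          ¬-elim (≤-trans (≤-trans s≤r r≤q) q≤¬⋁) (⋁-intro i (∧-greatest (≤-trans s≤r r≤∈) s≤¬b)))))
      fails)

    member : ∃[ k ] _∼_ 𝔹 U ν (check 𝔹 (set k))
    member = Equivalence.to (proj₂ j[𝔄]∈ ν) (U-up
      (⋁-elim ≤-refl λ i _ q≤d → ∈-respˡ (check 𝔹 (set i)) ν 𝔄̇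
        (≐-sym ν (check 𝔹 (set i)) (ν≐ i q≤d)) (∧-fst (≤-trans q≤d (disjoint-≤ i))))
      ⋁d∈U)

    k = proj₁ member
    ν∼k = proj₂ member

    -- Where `ν` equals both `check 𝔹 (set i)` and `check 𝔹 (set k)`, the two indices list one
    -- antichain, and `b-cong` carries the failure of `b i` over to `b k`.
    forced : ∀ {q} → q ≤ ⋁ disjoint → q ≤ ν ≐ check 𝔹 (set k) → q ≤ ¬ b k
    forced q≤⋁ q≤ν≐k = ⋁-elim q≤⋁ λ i {r} r≤q r≤d →
      [ (λ r≤⊥ → ≤-trans r≤⊥ ⊥≤)
      , (λ i≃k → subst (λ c → r ≤ ¬ c) (b-cong i k i≃k) (∧-snd (≤-trans r≤d (disjoint-≤ i)))) ]′
      (check-≃-reflect em 𝔹 {r} (set i) (set k)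
        (≐-trans (check 𝔹 (set i)) ν (check 𝔹 (set k))
          (≐-sym ν (check 𝔹 (set i)) (ν≐ i r≤d)) (≤-trans r≤q q≤ν≐k)))

  match : ∀ i k → set i ≃ set k → ∀ d → ∃[ d′ ] R.e i d ≈ R.e k d′
  match i k (p , _) d = let (b , ca≃cb) = p (R.ι i d) in
    R.ρ k b , ≈.trans (Equivalence.from (code-≃ _ _) ca≃cb) (≈.sym (R.ρ-≈ k b))

  -- Two indices of the same antichain may have different representatives; `f` is moved along the
  -- bijection matching equal conditions.
  transfer : ∀ i k → set i ≃ set k → (f : R.D i → V ℓ) →
             ∃[ g ] ∀ d → ∃[ d′ ] R.e i d ≈ R.e k d′ × f d ≡ g d′
  transfer i k i≃k f = f ∘ back , λ d →
    let (d′ , ed≈ed′) = match i k i≃k d in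
    d′ , ed≈ed′ , cong f (R.e-injective i d (back d′)
      (≈.trans ed≈ed′ (proj₂ (match k i (≃-sym (set i) (set k) i≃k) d′))))
    where
    back : R.D k → R.D i
    back d = proj₁ (match k i (≃-sym (set i) (set k) i≃k) d)

  private
    antichainSetoid : Setoid ℓ ℓ
    antichainSetoid = On.setoid {B = I} V-setoid set

    -- Several indices may list the same antichain; r makes the choice of f and H depend
    -- on the antichain only.
    r : I → I
    r = proj₁ (choice antichainSetoid)

    r-≃ : ∀ i → set (r i) ≃ set i
    r-≃ = proj₁ (proj₂ (choice antichainSetoid))

    r-cong : ∀ i k → set i ≃ set k → r i ≡ r k
    r-cong = proj₂ (proj₂ (choice antichainSetoid))

  -- From points of all the ultrapowers to one name

  module Cover {J : Set ℓ} (x : J → V ℓ)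
    (f : ∀ i → FunctionOn 𝔹 (𝔄 i)) (f-collapse : ∀ i → CollapsesTo (E[_] 𝔹 U (𝔄 i)) (f i) (sup J x))
    (σ : J → Name 𝔹) (σ-collapse : ∀ k → CollapsesTo (_E_ 𝔹 U) (σ k) (x k))
    (σ-cong : ∀ k l → x k ≃ x l → σ k ≡ σ l) where

    Captures : ∀ i → Name 𝔹 → R.D i → Set ℓ
    Captures i υ d = Func.to (S.collapse i υ) (R.ι i d) ∈V Func.to (f i) (R.ι i d)

    -- Some member of `f i` collapses to `x k`, and so does `S.collapse i (σ k)`; the two agree
    -- almost everywhere.
    AE-captures : ∀ i k → R.AE i (Captures i (σ k))
    AE-captures i k =
      let (n , nεf , c) = proj₂ (f-collapse i) k in
      R.AE-map₂ i
        (λ d → ∈V-respˡ (Func.to (f i) (R.ι i d)))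
        (R.CollapsesTo-injective i (S.collapse i (σ k)) n (x k)
          (S.collapse-CollapsesTo i (σ k) (x k) (σ-collapse k)) c)
        (R.ε⇒AE i n (f i) nεf)

    ψ : I → Name 𝔹 → Carrier
    ψ i υ = R.join i (Captures i υ)

    -- `U` need not be closed under infinite meets. Guarding each conjunct by membership in `𝔄̇`
    -- makes this a quantification over j[𝔄], to which `⋀-∈U` applies.
    φ : Name 𝔹 → Carrier
    φ υ = ⋀ (λ i → check 𝔹 (set i) ∈ 𝔄̇ ⇒ ψ (r i) υ)

    φ-∈U : ∀ k → φ (σ k) ∈U
    φ-∈U k = ⋀-∈U (λ i → ψ (r i) (σ k)) (λ i l i≃l → cong (λ i → ψ i (σ k)) (r-cong i l i≃l))
      (λ i → AE-captures (r i) k)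

    τ : Name 𝔹
    τ = name J σ (φ ∘ σ)

    -- The weights `w` split the statement that `n` belongs to `τ` into pieces on which `n` is some
    -- `σ k`, and `y` records the corresponding `x k` as an element of the ground model.
    module _ (n : Name 𝔹) (w : J → Carrier) (w-≤ : ∀ k → w k ≤ φ (σ k) ∧ n ≐ σ k) (⋁w∈U : ⋁ w ∈U)
      (y : Name 𝔹) (y≐ : ∀ k {q} → q ≤ w k → q ≤ y ≐ check 𝔹 (x k))
      (i₀ : I) (f₀ : FunctionOn 𝔹 (𝔄 i₀)) (π : Is-π∞ 𝔹 U (𝔄 i₀) f₀ y)
      (g : R.D (r i₀) → V ℓ)
      (moved : ∀ d₀ → ∃[ d ] R.e i₀ d₀ ≈ R.e (r i₀) d × Func.to f₀ (R.ι i₀ d₀) ≡ g d) where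
      private
        i = r i₀

        open R i using (D; e; e-disjoint; AE; AE-map₂; _at_)
        open S i using (H; ε)

        Q : D → J → Set ℓ
        Q d k = x k ≃ g d × Captures i (σ k) d

        κ : D → Carrier
        κ d = ⋁ {I = ∃ (Q d)} (λ (k , _) → n ≐ σ k)

        -- H d is a filter but not closed under splitting infinite joins, so it matters that
        -- all n ≐ σ k in this join are the same (by σ-cong).
        κ-≤ : ∀ d k → Q d k → κ d ≤ n ≐ σ k
        κ-≤ d k (xk≃gd , _) = ⋁-elim ≤-refl λ (l , xl≃gd , _) {q} _ →
          subst (λ υ → q ≤ n ≐ υ) (σ-cong l k (≃-trans (x l) (g d) (x k) xl≃gd (≃-sym (x k) (g d) xk≃gd)))

        i₀∈𝔄̇ : (check 𝔹 (set i₀) ∈ 𝔄̇) ∈U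
        i₀∈𝔄̇ = Equivalence.from (proj₂ j[𝔄]∈ (check 𝔹 (set i₀))) (i₀ , U-up (≐-refl (check 𝔹 (set i₀))) ⊤-mem)

        z = ⋁ (λ d → e d ∧ κ d)

        atPoint : ∀ d k {q} → q ≤ e d → q ≤ ψ i (σ k) → q ≤ n ≐ σ k → x k ≃ g d → q ≤ z
        atPoint d k q≤e q≤ψ n≐σk xk≃gd = R.join-elim i (Captures i (σ k)) q≤ψ λ d′ captures {r} r≤q r≤e′ →
          [ (λ d≡d′ → ⋁-intro d (∧-greatest (≤-trans r≤q q≤e)
              (⋁-intro (k , xk≃gd , subst (Captures i (σ k)) (sym d≡d′) captures) (≤-trans r≤q n≐σk))))
          , (λ r≤⊥ → ≤-trans r≤⊥ ⊥≤) ]′ (e-disjoint d d′ (≤-trans r≤q q≤e) r≤e′)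

        forced : ∀ {q} → q ≤ ⋁ w ∧ check 𝔹 (set i₀) ∈ 𝔄̇ →
                 q ≤ ⋁ (λ d → R.e i₀ d ∧ y ≐ check 𝔹 (Func.to f₀ (R.ι i₀ d))) → q ≤ z
        forced q≤ q≤⋁ =
          ⋁-elim (∧-fst q≤) λ k r≤q r≤d →
          ⋁-elim (≤-trans r≤q q≤⋁) λ d₀ {s} s≤r s≤ →
          let s≤d = ≤-trans s≤r r≤d
              s≤w = ≤-trans s≤d (w-≤ k)
              -- The conjunct of `φ` at `i₀`, the index that represents `y`.
              s≤ψ = ⇒-elim (⋀-elim (∧-fst s≤w) i₀) (≤-trans s≤r (≤-trans r≤q (∧-snd q≤)))
              (d , e₀≈e , f₀≡g) = moved d₀
          in [ (λ s≤⊥ → ≤-trans s≤⊥ ⊥≤)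
             , (λ xk≃f₀ → atPoint d k (≤-trans (∧-fst s≤) (≤-reflexive e₀≈e)) s≤ψ (∧-snd s≤w)
                 (subst (x k ≃_) f₀≡g xk≃f₀)) ]′
             (check-≃-reflect em 𝔹 {s} (x k) (Func.to f₀ (R.ι i₀ d₀))
               (≐-trans (check 𝔹 (x k)) y (check 𝔹 (Func.to f₀ (R.ι i₀ d₀)))
                 (≐-sym y (check 𝔹 (x k)) (y≐ k s≤d)) (∧-snd s≤)))

        AE-κ : AE (λ d → H d (κ d))
        AE-κ = S.Łoś-from i κ (U-deduce₂ forced
          (∧-mem _ _ ⋁w∈U i₀∈𝔄̇) (R.Is-π∞⇒∈U i₀ f₀ y π))

      -- By `AE-κ`, almost every `H d` contains the value of `n ≐ σ k` for some `k` captured at `d`,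
      -- so `n` and `σ k` have the same collapse there.
      captured-member : E[_] 𝔹 U (𝔄 i) (S.collapse i n) (f i)
      captured-member = R.AE⇒ε i (S.collapse i n) (f i) (AE-map₂ captured
          (AE-map₂ (λ _ → _,_) (S.AE-filter i) (S.AE-H-proper i))
          (AE-map₂ (λ _ → _,_) (S.AE-collapse i n) AE-κ))
          where
          captured : ∀ d → IsFilter 𝔹 (H d) × Not H d ⊥ →
                     CollapsesTo (ε d) n (S.collapse i n at d) × H d (κ d) → Captures i n d
          captured d (filter , proper) (c , Hκ) with em {P = ∃ (Q d)}
          -- With no such `k`, `κ d` is an empty join, and `H d` would contain `⊥`.
          ... | no none = contradiction
            (IsFilter.upward filter (⋁-elim ≤-refl λ q → contradiction q none) Hκ) proper
          ... | yes (k , q) = ∈V-respˡ (f i at d)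
            (≃-sym (S.collapse i (σ k) at d) (S.collapse i n at d)
              (S.collapse-≃ i (σ k) d (S.collapse i n at d)
                (Reduced.CollapsesTo-resp-≋ 𝔹 filter n (σ k) (S.collapse i n at d)
                  (IsFilter.upward filter (κ-≤ d k q) Hκ) c)))
            (proj₂ q)

    τ-members : ∀ n → _E_ 𝔹 U n τ → ∃[ k ] CollapsesTo (_E_ 𝔹 U) n (x k)
    τ-members n nEτ =
      let (i₀ , f₀ , π) = Equivalence.to (generate y) (Ground-intro y disjoint x (λ k → y≐ k ≤-refl) ⋁d∈U)
          i = r i₀
          -- `φ` evaluates `ψ` at the representative index `r i₀`, so `f₀` is carried over to that
          -- listing of the antichain.
          (g , moved) = transfer i₀ i (≃-sym (set i) (set i₀) (r-≃ i₀)) (λ d → Func.to f₀ (R.ι i₀ d))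
          (k , c) = proj₁ (f-collapse i) (S.collapse i n)
                      (captured-member n disjoint disjoint-≤ ⋁d∈U y y≐ i₀ f₀ π g moved)
      in k , S.CollapsesTo-collapse i n (x k) c
      where
      open Disjoint em 𝔹 choice (λ k → φ (σ k) ∧ n ≐ σ k)

      ⋁d∈U : ⋁ disjoint ∈U
      ⋁d∈U = U-up ⋁-≤-⋁-disjoint nEτ

      y : Name 𝔹
      y = mixture disjoint (check 𝔹 ∘ x)

      y≐ : ∀ k {q} → q ≤ disjoint k → q ≤ y ≐ check 𝔹 (x k)
      y≐ = mixture-≐ disjoint (check 𝔹 ∘ x) λ k l {q} q≤k q≤l →
        [ (λ k≡l → subst (λ l → q ≤ check 𝔹 (x k) ≐ check 𝔹 (x l)) k≡l (≐-refl (check 𝔹 (x k))))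
        , (λ q≤⊥ → ≤-trans q≤⊥ ⊥≤) ]′ (disjoint-≡ k l q≤k q≤l)

    τ-collapse : CollapsesTo (_E_ 𝔹 U) τ (sup J x)
    τ-collapse = τ-members ,
      λ k → σ k , U-up (∈-intro (σ k) τ k ≤-refl (≐-refl (σ k))) (φ-∈U k) , σ-collapse k

  BooleanModel⊆M : ∀ {x} → BooleanModel 𝔹 U x → ∀ i → M[_] 𝔹 U (𝔄 i) x
  BooleanModel⊆M {x} (σ , c) i = S.collapse i σ , S.collapse-CollapsesTo i σ x c

  ⋂M⊆BooleanModel : ∀ x → (∀ i → M[_] 𝔹 U (𝔄 i) x) → BooleanModel 𝔹 U x
  ⋂M⊆BooleanModel (sup J x) h = τ , τ-collapse
    where
    names : ∀ k → BooleanModel 𝔹 U (x k)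
    names k = ⋂M⊆BooleanModel (x k) λ i →
      let (n , _ , c) = proj₂ (proj₂ (h i)) k in n , c

    indexSetoid : Setoid ℓ ℓ
    indexSetoid = On.setoid {B = J} V-setoid x

    -- Names are taken at representatives of the classes of equal `x k`; this yields `σ-cong` with
    -- `_≡_`.
    rep : J → J
    rep = proj₁ (choice indexSetoid)

    open Cover x (λ i → proj₁ (h i)) (λ i → proj₂ (h i))
      (λ k → proj₁ (names (rep k)))
      (λ k → CollapsesTo-resp-≃ (_E_ 𝔹 U) (x (rep k)) (x k) (proj₁ (proj₂ (choice indexSetoid)) k)
               (proj₂ (names (rep k))))
      (λ k l xk≃xl → cong (λ k → proj₁ (names k)) (proj₂ (proj₂ (choice indexSetoid)) k l xk≃xl))

open import Relation.Unary using (_≐_; ⋂)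

theorem3p9 : (∀ {a : Level} → ExcludedMiddle a) →
    {ℓ : Level} → Choice ℓ →
    (𝔹 : CompleteBooleanAlgebra ℓ) (U : Ultrafilter 𝔹) →
    WellFounded (_E_ 𝔹 U) →
    (I : Set ℓ) (𝔄 : I → MaximalAntichain 𝔹) →
    IsSkeleton 𝔹 U 𝔄 →
    (∀ i → Simple 𝔹 U (𝔄 i)) →
    BooleanModel 𝔹 U ≐ ⋂ I (λ i → M[_] 𝔹 U (𝔄 i))
theorem3p9 em choice 𝔹 U wellFounded I 𝔄 skeleton simple =
  BooleanModel⊆M , λ {x} → ⋂M⊆BooleanModel x
  where open Skeleton em choice 𝔹 U wellFounded I 𝔄 skeleton simple
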